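{- There exist absolute constants $A, B > 0$ and $t \in \mathbb{N}$ such that the following holds. Let $2 \leq k \leq 5$ and $2 \leq m \leq k$ be integers, let $r$ be a positive integer, and let $G = \mathbb{F}_2^n$ for some $n$. Let $\alpha \colon G^k \to \mathbb{F}_2$ be a multilinear form which is symmetric in the first $m$ variables. Suppose also that the multilinear form $(d, a_3, \dots, a_k) \mapsto \alpha(d,d,a_3,\dots,a_k)$ on $G^{k-1}$ has partition rank at most $r$. Then there exist a subspace $U \leq G$ of codimension at most $\exp^{(t)}(Ar)$ and a multilinear form $\alpha' \colon U^k \to \mathbb{F}_2$, also symmetric in the first $m$ variables, such that $\alpha'(d,d,a_3,\dots,a_k) = 0$ for all $d, a_3, \dots, a_k \in U$ and $\operatorname{prank}(\alpha|_{U \times \cdots \times U} + \alpha') \leq \exp(\exp(A r^{B}))$.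
   Context: A form is symmetric in a set of variables if it is invariant under all permutations of those variables. $\exp^{(t)}$ denotes the $t$-fold composition of the exponential function. For a finite-dimensional $\mathbb{F}_2$-vector space $V$, the partition rank $\operatorname{prank}\alpha$ of a multilinear form $\alpha \colon V^k \to \mathbb{F}_2$ is the least non-negative integer $m$ such that \[\alpha(x_1,\dots,x_k) = \sum_{i=1}^m \beta_i(x_j : j \in I_i)\,\gamma_i(x_j : j \in [k]\setminus I_i)\] for some sets $\emptyset \neq I_i \subsetneq [k]$ and multilinear forms $\beta_i \colon V^{I_i} \to \mathbb{F}_2$, $\gamma_i \colon V^{[k]\setminus I_i} \to \mathbb{F}_2$. (For $k=1$, with no admissible sets $I_i$, the zero form has partition rank $0$ and a non-zero linear form has partition rank $\infty$.) -}

module Defs where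

open import Algebra.Construct.Pointwise as Pointwise using ()
open import Algebra.Definitions.RawMonoid as RawMonoid using ()
open import Algebra.Module.Bundles using (LeftModule)
open import Data.Fin.Base using (Fin; toℕ; pinch)
open import Data.Fin.Permutation using (Permutation′; _⟨$⟩ʳ_)
open import Data.Fin.Subset using (Subset; Nonempty; ∁; _∈_; _⊂_; ⊤)
open import Data.Integer.Base using (+_)
open import Data.Nat.Base as ℕ using (ℕ; zero; suc; pred; s≤s)
open import Data.Nat.Properties as ℕ using ()
open import Data.Parity.Base as ℙ using (Parity; 0ℙ; 1ℙ)
open import Data.Parity.Properties as ℙ using ()
open import Data.Product.Base using (Σ; ∃; ∃-syntax; _×_; _,_; proj₁)
open import Data.Rational.Base as ℚ using (ℚ; 0ℚ; 1ℚ)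
open import Data.Vec.Functional using (Vector)
open import Function.Base using (_∘_)
open import Function.Bundles using (_⇔_; mk⇔)
open import Level using (0ℓ)
open import Relation.Binary.PropositionalEquality using (_≡_; _≢_; refl; cong₂)
open import Relation.Unary using (Pred)

infix 8 F₂^_
infix 4 _≤ℝ_

F₂ : Set
F₂ = Parity

VectorSpace : Set₁
VectorSpace = LeftModule ℙ.+-*-ring 0ℓ 0ℓ

∣_∣ : VectorSpace → Set
∣ V ∣ = LeftModule.Carrierᴹ V

F₂^_ : ℕ → VectorSpace
F₂^ n = record
  { Carrierᴹ     = Vector F₂ n
  ; _≈ᴹ_         = λ u v → ∀ i → u i ≡ v i
  ; _+ᴹ_         = λ u v i → u i ℙ.+ v i
  ; _*ₗ_         = λ c v i → c ℙ.* v i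
  ; 0ᴹ           = λ _ → 0ℙ
  ; -ᴹ_          = λ v → v
  ; isLeftModule = record
    { isLeftSemimodule = record
      { +ᴹ-isCommutativeMonoid =
          Pointwise.isCommutativeMonoid (Fin n) ℙ.+-0-isCommutativeMonoid
      ; isPreleftSemimodule = record
        { *ₗ-cong      = λ c≡d u≈v i → cong₂ ℙ._*_ c≡d (u≈v i)
        ; *ₗ-zeroˡ     = λ _ _ → refl
        ; *ₗ-distribʳ  = λ v c d i → ℙ.*-distribʳ-+ (v i) c d
        ; *ₗ-identityˡ = λ _ _ → refl
        ; *ₗ-assoc     = λ c d v i → ℙ.*-assoc c d (v i)
        ; *ₗ-zeroʳ     = λ c _ → ℙ.*-zeroʳ c
        ; *ₗ-distribˡ  = λ c u v i → ℙ.*-distribˡ-+ c (u i) (v i)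
        }
      }
    ; -ᴹ‿cong    = λ u≈v → u≈v
    ; -ᴹ‿inverse = (λ v i → ℙ.p+p≡0ℙ (v i)) , (λ v i → ℙ.p+p≡0ℙ (v i))
    }
  }

record Subspace (V : VectorSpace) : Set₁ where
  open LeftModule V
  field
    Member   : Pred Carrierᴹ 0ℓ
    resp     : ∀ {u v} → u ≈ᴹ v → Member u → Member v
    0-closed : Member 0ᴹ
    +-closed : ∀ {u v} → Member u → Member v → Member (u +ᴹ v)
    *-closed : ∀ c {v} → Member v → Member (c *ₗ v)

  private
    v+v≈0 : ∀ v → v +ᴹ v ≈ᴹ 0ᴹ
    v+v≈0 v = ≈ᴹ-trans
      (+ᴹ-cong (≈ᴹ-sym (*ₗ-identityˡ v)) (≈ᴹ-sym (*ₗ-identityˡ v)))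
      (≈ᴹ-trans (≈ᴹ-sym (*ₗ-distribʳ v 1ℙ 1ℙ)) (*ₗ-zeroˡ v))

  space : VectorSpace
  space = record
    { Carrierᴹ     = ∃ Member
    ; _≈ᴹ_         = λ u v → proj₁ u ≈ᴹ proj₁ v
    ; _+ᴹ_         = λ { (u , u∈) (v , v∈) → u +ᴹ v , +-closed u∈ v∈ }
    ; _*ₗ_         = λ { c (v , v∈) → c *ₗ v , *-closed c v∈ }
    ; 0ᴹ           = 0ᴹ , 0-closed
    ; -ᴹ_          = λ v → v
    ; isLeftModule = record
      { isLeftSemimodule = record
        { +ᴹ-isCommutativeMonoid = record
          { isMonoid = record
            { isSemigroup = record
              { isMagma = record
                { isEquivalence = record
                  { refl = ≈ᴹ-refl ; sym = ≈ᴹ-sym ; trans = ≈ᴹ-trans }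
                ; ∙-cong = +ᴹ-cong
                }
              ; assoc = λ u v w → +ᴹ-assoc (proj₁ u) (proj₁ v) (proj₁ w)
              }
            ; identity = (λ v → +ᴹ-identityˡ (proj₁ v)) , (λ v → +ᴹ-identityʳ (proj₁ v))
            }
          ; comm = λ u v → +ᴹ-comm (proj₁ u) (proj₁ v)
          }
        ; isPreleftSemimodule = record
          { *ₗ-cong      = *ₗ-cong
          ; *ₗ-zeroˡ     = λ v → *ₗ-zeroˡ (proj₁ v)
          ; *ₗ-distribʳ  = λ v → *ₗ-distribʳ (proj₁ v)
          ; *ₗ-identityˡ = λ v → *ₗ-identityˡ (proj₁ v)
          ; *ₗ-assoc     = λ c d v → *ₗ-assoc c d (proj₁ v)
          ; *ₗ-zeroʳ     = *ₗ-zeroʳ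
          ; *ₗ-distribˡ  = λ c u v → *ₗ-distribˡ c (proj₁ u) (proj₁ v)
          }
        }
      ; -ᴹ‿cong    = λ u≈v → u≈v
      ; -ᴹ‿inverse = (λ v → v+v≈0 (proj₁ v)) , (λ v → v+v≈0 (proj₁ v))
      }
    }

  inclusion : ∣ space ∣ → ∣ V ∣
  inclusion = proj₁

module _ (V : VectorSpace) where
  open LeftModule V
  open RawMonoid +ᴹ-rawMonoid using (sum)

  record IsBasis {d : ℕ} (b : Vector Carrierᴹ d) : Set where
    field
      spanning    : ∀ v → Σ (Vector F₂ d) λ c → v ≈ᴹ sum (λ i → c i *ₗ b i)
      independent : ∀ (c : Vector F₂ d) → sum (λ i → c i *ₗ b i) ≈ᴹ 0ᴹ → ∀ i → c i ≡ 0ℙ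

  HasDimension : ℕ → Set
  HasDimension d = ∃ (IsBasis {d})

HasCodimension : {V : VectorSpace} → Subspace V → ℕ → Set
HasCodimension {V} U c =
  ∃[ d ] HasDimension (Subspace.space U) d × HasDimension V (c ℕ.+ d)

-- Arguments are indexed by an arbitrary set J so that a form on V^I, for a
-- subset I of the variables, is a function of the variables in I only.
record IsMultilinear (V : VectorSpace) {J : Set} (f : (J → ∣ V ∣) → F₂) : Set where
  open LeftModule V
  field
    cong        : ∀ {x y} → (∀ j → x j ≈ᴹ y j) → f x ≡ f y
    additive    : ∀ j {x y z} →
                  (∀ i → i ≢ j → y i ≈ᴹ x i) → (∀ i → i ≢ j → z i ≈ᴹ x i) →
                  x j ≈ᴹ y j +ᴹ z j → f x ≡ f y ℙ.+ f z
    homogeneous : ∀ j c {x y} →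
                  (∀ i → i ≢ j → x i ≈ᴹ y i) →
                  x j ≈ᴹ c *ₗ y j → f x ≡ c ℙ.* f y

SymmetricInFirst : ∀ {A : Set} {k} → ℕ → ((Fin k → A) → F₂) → Set
SymmetricInFirst {k = k} m f =
  (π : Permutation′ k) → (∀ j → m ℕ.≤ toℕ j → π ⟨$⟩ʳ j ≡ j) →
  ∀ x → f (x ∘ (π ⟨$⟩ʳ_)) ≡ f x

-- Sends 0 and 1 to 0, and j to j - 1 for j ≥ 1.
merge : ∀ {k} → 2 ℕ.≤ k → Fin k → Fin (pred k)
merge (s≤s (s≤s _)) = pinch Fin.zero

-- (d , a₃ , … , aₖ) ↦ f (d , d , a₃ , … , aₖ)
diagonal : ∀ {A : Set} {k} → 2 ℕ.≤ k → ((Fin k → A) → F₂) → (Fin (pred k) → A) → F₂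
diagonal 2≤k f x = f (x ∘ merge 2≤k)

restrict : ∀ {A : Set} {k} (I : Subset k) → (Fin k → A) → ∃ (_∈ I) → A
restrict I x = x ∘ proj₁

module _ (V : VectorSpace) {k : ℕ} where

  record PartitionDecomposition (f : (Fin k → ∣ V ∣) → F₂) (m : ℕ) : Set where
    open RawMonoid ℙ.+-0-rawMonoid using (sum)
    field
      I             : Fin m → Subset k
      nonempty      : ∀ i → Nonempty (I i)
      proper        : ∀ i → I i ⊂ ⊤
      β             : ∀ i → (∃ (_∈ I i) → ∣ V ∣) → F₂
      γ             : ∀ i → (∃ (_∈ ∁ (I i)) → ∣ V ∣) → F₂
      β-multilinear : ∀ i → IsMultilinear V (β i)
      γ-multilinear : ∀ i → IsMultilinear V (γ i)
      decomposes    : ∀ x → f x ≡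
        sum (λ i → β i (restrict (I i) x) ℙ.* γ i (restrict (∁ (I i)) x))

  -- prank f = p < ∞
  HasPartitionRank : ((Fin k → ∣ V ∣) → F₂) → ℕ → Set
  HasPartitionRank f p =
    PartitionDecomposition f p × (∀ m → PartitionDecomposition f m → p ℕ.≤ m)

  -- prank f ≤ r
  PartitionRankAtMost : ((Fin k → ∣ V ∣) → F₂) → ℕ → Set
  PartitionRankAtMost f r = ∃[ m ] m ℕ.≤ r × PartitionDecomposition f m

  partitionRankAtMost⇔≤ : ∀ {f p} → HasPartitionRank f p →
                          ∀ r → PartitionRankAtMost f r ⇔ p ℕ.≤ r
  partitionRankAtMost⇔≤ {p = p} (D , least) r = mk⇔
    (λ { (m , m≤r , E) → ℕ.≤-trans (least m E) m≤r })
    (λ p≤r → p , p≤r , D)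

-- A real number is given by a sequence of rationals converging to it.
Approx : Set
Approx = ℕ → ℚ

fromℕ : ℕ → Approx
fromℕ n _ = + n ℚ./ 1

expTerm : ℚ → ℕ → ℚ
expTerm q zero    = 1ℚ
expTerm q (suc i) = expTerm q i ℚ.* (q ℚ.* (+ 1 ℚ./ suc i))

expSum : ℚ → ℕ → ℚ
expSum q zero    = expTerm q zero
expSum q (suc i) = expSum q i ℚ.+ expTerm q (suc i)

-- The Taylor series of exp converges uniformly on bounded sets, so xₙ → x
-- implies ∑_{i ≤ n} xₙ^i / i! → exp x.
exp : Approx → Approx
exp x n = expSum (x n) n

exp^ : ℕ → Approx → Approx
exp^ zero    x = x
exp^ (suc t) x = exp (exp^ t x)

-- The natural number m is at most the limit of x.
_≤ℝ_ : ℕ → Approx → Set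
m ≤ℝ x = ∀ ε → 0ℚ ℚ.< ε → ∃[ N ] ∀ n → N ℕ.≤ n → (+ m ℚ./ 1) ℚ.≤ x n ℚ.+ ε

-- Let φ(d, a₃, …) = α(d, d, a₃, …). If b is a basis of U with coordinates c, put
--   σ(x) = ∑_{p<q<m} ∑_l c_l(x_p) c_l(x_q) α(x with b_l in positions p and q).
-- This is symmetric in the first m variables. By symmetry of α each of its at
-- most k² pairs (p, q) contributes partition rank at most prank φ, since
-- c_l(x_p) c_l(x_q) can be absorbed into the factor that contains d in each
-- product of φ. On x₀ = x₁ = d the pair (0, 1) gives φ, the pairs (0, j) and
-- (1, j) cancel, and the pairs (i, j) with 1 < i < j contribute nothing provided
-- that α vanishes whenever x₀ = x₁ and x_i = x_j. Then α′ = α + σ works.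
--
-- The condition is arranged by linear equations. It is vacuous for k ≤ 3. For
-- k = 4 every product in φ has a factor in a single variable, which is killed.
-- For k = 5, after killing such factors, φ(e, a, b, c) is a sum of products
-- f(e,a) g(b,c), f(e,b) g(a,c) and s(a,b) s′(e,c). A sum of N products in which
-- the variables are separated is determined by N values of one side, so O(r²)
-- linear equations kill the sum of the products separating a from b. Then
-- φ(e, d, d, c) = ∑ s(d,d) s′(e,c) is killed by another r linear equations.

module Submission where

open import Defs
open import Data.Fin.Base using (Fin)
open import Data.Nat.Base using (ℕ; _≤_; _<_; _*_; _^_)
open import Data.Parity.Base using (0ℙ; _+_)
open import Data.Product.Base using (Σ; ∃-syntax; _×_)
open import Function.Base using (_∘_)
open import Relation.Binary.PropositionalEquality using (_≡_)

open import Algebra.Module.Bundles using (LeftModule)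
import Algebra.Properties.CommutativeMonoid.Sum as MonoidSum
import Algebra.Properties.CommutativeSemigroup as CommSemigroup
import Algebra.Properties.Semiring.Sum as SemiringSum
open import Data.Bool.Base using (Bool; true; false; _∧_; T)
open import Data.Empty using (⊥-elim)
open import Data.Fin.Base using (zero; suc; toℕ; pinch; punchIn)
open import Data.Fin.Patterns using (0F; 1F; 2F; 3F; 4F)
open import Data.Fin.Permutation as Perm using (Permutation′; _⟨$⟩ʳ_; _⟨$⟩ˡ_; transpose; _∘ₚ_)
open import Data.Fin.Properties as Fin using (_≟_; any?; all?)
open import Data.Fin.Subset using (Subset; inside; outside; Nonempty; ∁; ⁅_⁆; _∪_; _∈_)
open import Data.Fin.Subset.Properties
  using (_∈?_; ∈⊤; ∉⊥; x∈∁p⇒x∉p; x∉p⇒x∈∁p; x∈⁅x⁆; x∈⁅y⁆⇒x≡y; x∈p∪q⁺; x∈p∪q⁻)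
open import Data.Integer.Base as ℤ using ()
import Data.Integer.Properties as ℤ
open import Data.List.Base using (List; []; _∷_; length; _++_)
import Data.List.Properties as List
open import Data.List.Relation.Unary.All as All using (All; []; _∷_)
import Data.List.Relation.Unary.All.Properties as All
open import Data.Nat.Base as ℕ using (zero; suc; s≤s; z≤n; _<ᵇ_)
import Data.Nat.Properties as ℕ
open import Data.Nat.Tactic.RingSolver using (solve-∀)
open import Data.Parity.Base using (1ℙ) renaming (_*_ to infixl 8 _·_)
import Data.Parity.Properties as ℙ
open import Data.Product.Base using (∃; _,_; proj₁; proj₂)
open import Data.Rational.Base as ℚ using (ℚ; 0ℚ; 1ℚ)
import Data.Rational.Properties as ℚ
open import Data.Rational.Unnormalised.Base as ℚᵘ using (mkℚᵘ; *≡*; *≤*)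
import Data.Rational.Unnormalised.Properties as ℚᵘ
open import Data.Sum.Base using (_⊎_; inj₁; inj₂)
open import Data.Vec.Base using ([]; _∷_; lookup; tabulate)
open import Data.Vec.Functional as Vector using (Vector; insertAt)
open import Data.Vec.Functional.Properties using (insertAt-lookup; insertAt-punchIn)
open import Data.Vec.Properties using ([]=⇒lookup; lookup⇒[]=; lookup∘tabulate)
open import Data.Vec.Properties.WithK using ([]=-irrelevant)
open import Function.Base using (const)
open import Level using (0ℓ)
open import Relation.Binary.Definitions using (DecidableEquality; tri<; tri≈; tri>)
open import Relation.Binary.PropositionalEquality
  using (_≢_; refl; sym; trans; cong; cong₂; subst; subst₂; module ≡-Reasoning)
open import Relation.Nullary using (Dec; ¬_; yes; no)
open import Relation.Unary using (Pred; U; Decidable)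

open SemiringSum ℙ.+-*-semiring
open CommSemigroup ℙ.+-commutativeSemigroup using () renaming (interchange to +-interchange)

-- Multilinear forms and partition rank

p≡p+p⇒p≡0 : ∀ {p : F₂} → p ≡ p + p → p ≡ 0ℙ
p≡p+p⇒p≡0 {p} eq = trans eq (ℙ.p+p≡0ℙ p)

p+q≡0⇒p≡q : ∀ {p q : F₂} → p + q ≡ 0ℙ → p ≡ q
p+q≡0⇒p≡q {0ℙ} {0ℙ} _ = refl
p+q≡0⇒p≡q {1ℙ} {1ℙ} _ = refl

sum-zero : ∀ {n} {f : Vector F₂ n} → (∀ i → f i ≡ 0ℙ) → sum f ≡ 0ℙ
sum-zero {n} f≡0 = trans (sum-cong-≗ f≡0) (sum-replicate-zero n)

module Forms (V : VectorSpace) where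
  open LeftModule V
  module ΣV = MonoidSum +ᴹ-commutativeMonoid

  record IsLinear (ψ : Carrierᴹ → F₂) : Set where
    field
      ≈-cong : ∀ {u v} → u ≈ᴹ v → ψ u ≡ ψ v
      +-homo : ∀ u v → ψ (u +ᴹ v) ≡ ψ u + ψ v

    0-homo : ψ 0ᴹ ≡ 0ℙ
    0-homo = p≡p+p⇒p≡0 (trans (≈-cong (≈ᴹ-sym (+ᴹ-identityˡ 0ᴹ))) (+-homo 0ᴹ 0ᴹ))

    *-homo : ∀ c v → ψ (c *ₗ v) ≡ c · ψ v
    *-homo 0ℙ v = trans (≈-cong (*ₗ-zeroˡ v)) 0-homo
    *-homo 1ℙ v = ≈-cong (*ₗ-identityˡ v)

    sum-homo : ∀ {d} (c : Vector F₂ d) (b : Vector Carrierᴹ d) →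
               ψ (ΣV.sum (λ i → c i *ₗ b i)) ≡ sum (λ i → c i · ψ (b i))
    sum-homo {zero}  c b = 0-homo
    sum-homo {suc d} c b = trans (+-homo _ _)
      (cong₂ _+_ (*-homo (c zero) (b zero)) (sum-homo (c ∘ suc) (b ∘ suc)))

  -- Encodes a form in the variables satisfying `P` as a function of all variables; `local` says
  -- that the others are ignored. The factors of a product then live on the same tuples as the
  -- product, whatever their sets of variables.
  record MultilinearIn {J : Set} (P : Pred J 0ℓ) (f : (J → Carrierᴹ) → F₂) : Set where
    field
      local : ∀ {x y} → (∀ j → P j → x j ≈ᴹ y j) → f x ≡ f y
      additive : ∀ {j} → P j → ∀ {x y z} →
                 (∀ i → i ≢ j → y i ≈ᴹ x i) → (∀ i → i ≢ j → z i ≈ᴹ x i) →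
                 x j ≈ᴹ y j +ᴹ z j → f x ≡ f y + f z

  v≈v+v : ∀ {v} → v ≈ᴹ 0ᴹ → v ≈ᴹ v +ᴹ v
  v≈v+v v≈0 = ≈ᴹ-trans v≈0 (≈ᴹ-trans (≈ᴹ-sym (+ᴹ-identityˡ 0ᴹ)) (≈ᴹ-sym (+ᴹ-cong v≈0 v≈0)))

  -- Over F₂ homogeneity follows from additivity.
  isMultilinear : ∀ {J} {f : (J → Carrierᴹ) → F₂} → DecidableEquality J →
                  MultilinearIn U f → IsMultilinear V f
  isMultilinear {f = f} _≟ᴶ_ F = record
    { cong        = λ x≈y → local (λ j _ → x≈y j)
    ; additive    = λ j → additive _
    ; homogeneous = homogeneous
    }
    where
    open MultilinearIn F
    homogeneous : ∀ j c {x y} → (∀ i → i ≢ j → x i ≈ᴹ y i) →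
                  x j ≈ᴹ c *ₗ y j → f x ≡ c · f y
    -- If slot `j` holds zero, then `x` splits there into `x` and `x`, so `f x` equals `f x + f x`.
    homogeneous j 0ℙ {x} {y} x≈y xⱼ≈ = p≡p+p⇒p≡0
      (additive {j} _ (λ _ _ → ≈ᴹ-refl) (λ _ _ → ≈ᴹ-refl) (v≈v+v (≈ᴹ-trans xⱼ≈ (*ₗ-zeroˡ (y j)))))
    homogeneous j 1ℙ {x} {y} x≈y xⱼ≈ = local eq
      where
      eq : ∀ i → U i → x i ≈ᴹ y i
      eq i _ with i ≟ᴶ j
      ... | yes refl = ≈ᴹ-trans xⱼ≈ (*ₗ-identityˡ (y j))
      ... | no  i≢j  = x≈y i i≢j

  multilinearIn : ∀ {J} {f : (J → Carrierᴹ) → F₂} → IsMultilinear V f → MultilinearIn U f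
  multilinearIn F = record
    { local    = λ x≈y → IsMultilinear.cong F (λ j → x≈y j _)
    ; additive = λ {j} _ → IsMultilinear.additive F j
    }

  ⇔-multilinear : ∀ {J} {P Q : Pred J 0ℓ} {f : (J → Carrierᴹ) → F₂} →
                   (∀ {j} → P j → Q j) → (∀ {j} → Q j → P j) →
                   MultilinearIn P f → MultilinearIn Q f
  ⇔-multilinear P⇒Q Q⇒P F = record
    { local    = λ x≈y → MultilinearIn.local F (λ j → x≈y j ∘ P⇒Q)
    ; additive = λ q → MultilinearIn.additive F (Q⇒P q)
    }

  0-multilinear : ∀ {J} {P : Pred J 0ℓ} → MultilinearIn P (const 0ℙ)
  0-multilinear = record { local = λ _ → refl ; additive = λ _ _ _ _ → refl }

  +-multilinear : ∀ {J} {P : Pred J 0ℓ} {f g : (J → Carrierᴹ) → F₂} →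
                  MultilinearIn P f → MultilinearIn P g → MultilinearIn P (λ x → f x + g x)
  +-multilinear {f = f} {g} F G = record
    { local    = λ x≈y → cong₂ _+_ (MultilinearIn.local F x≈y) (MultilinearIn.local G x≈y)
    ; additive = λ j {_} {y} {z} y≈x z≈x eq → trans
        (cong₂ _+_ (MultilinearIn.additive F j y≈x z≈x eq) (MultilinearIn.additive G j y≈x z≈x eq))
        (+-interchange (f y) (f z) (g y) (g z))
    }

  *-multilinear : ∀ {J} {P : Pred J 0ℓ} {f : (J → Carrierᴹ) → F₂} c →
                  MultilinearIn P f → MultilinearIn P (λ x → c · f x)
  *-multilinear 0ℙ F = 0-multilinear
  *-multilinear 1ℙ F = F

  sum-multilinear : ∀ {J} {P : Pred J 0ℓ} {d} {f : Fin d → (J → Carrierᴹ) → F₂} →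
                    (∀ l → MultilinearIn P (f l)) → MultilinearIn P (λ x → sum (λ l → f l x))
  sum-multilinear {d = zero}  F = 0-multilinear
  sum-multilinear {d = suc d} F = +-multilinear (F zero) (sum-multilinear (F ∘ suc))

  module _ {k : ℕ} {I : Subset k} where

    restrict-multilinear : ∀ {β} → IsMultilinear V β → MultilinearIn (_∈ I) (β ∘ restrict I)
    restrict-multilinear B = record
      { local    = λ x≈y → IsMultilinear.cong B (λ { (j , j∈I) → x≈y j j∈I })
      ; additive = λ {j} j∈I y≈x z≈x → IsMultilinear.additive B (j , j∈I)
          (λ { (i , i∈I) i≢j → y≈x i (i≢j ∘ index-≡ i∈I j∈I) })
          (λ { (i , i∈I) i≢j → z≈x i (i≢j ∘ index-≡ i∈I j∈I) })
      }
      where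
      -- Membership proofs are unique, so indices that differ as pairs differ as variables.
      index-≡ : ∀ {i j} (i∈I : i ∈ I) (j∈I : j ∈ I) → i ≡ j → (i , i∈I) ≡ (j , j∈I)
      index-≡ i∈I j∈I refl = cong (_ ,_) ([]=-irrelevant i∈I j∈I)

    -- The default `0ᴹ` fills the slots outside `I`; a form local to `I` does not see it.
    extend : (∃ (_∈ I) → Carrierᴹ) → Fin k → Carrierᴹ
    extend x j with j ∈? I
    ... | yes j∈I = x (j , j∈I)
    ... | no  _   = 0ᴹ

    extend-≈ : ∀ {x y} j → (∀ j∈I → x (j , j∈I) ≈ᴹ y (j , j∈I)) → extend x j ≈ᴹ extend y j
    extend-≈ j x≈y with j ∈? I
    ... | yes j∈I = x≈y j∈I
    ... | no  _   = ≈ᴹ-refl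

    extend-+ : ∀ {x y z} j → j ∈ I → (∀ j∈I → x (j , j∈I) ≈ᴹ y (j , j∈I) +ᴹ z (j , j∈I)) →
               extend x j ≈ᴹ extend y j +ᴹ extend z j
    extend-+ j j∈I x≈y+z with j ∈? I
    ... | yes j∈I′ = x≈y+z j∈I′
    ... | no  j∉I  = ⊥-elim (j∉I j∈I)

    extend-restrict : ∀ x j → j ∈ I → x j ≈ᴹ extend (restrict I x) j
    extend-restrict x j j∈I with j ∈? I
    ... | yes _   = ≈ᴹ-refl
    ... | no  j∉I = ⊥-elim (j∉I j∈I)

    extend-multilinear : ∀ {f} → MultilinearIn (_∈ I) f → IsMultilinear V (f ∘ extend)
    extend-multilinear F = isMultilinear _≟ᴵ_ record
      { local    = λ x≈y → local (λ j _ → extend-≈ j (λ j∈I → x≈y (j , j∈I) _))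
      ; additive = λ { {j , j∈I} _ {x} {y} {z} y≈x z≈x eq → additive j∈I
          (λ i i≢j → extend-≈ i (λ i∈I → y≈x (i , i∈I) (i≢j ∘ cong proj₁)))
          (λ i i≢j → extend-≈ i (λ i∈I → z≈x (i , i∈I) (i≢j ∘ cong proj₁)))
          (extend-+ {x} {y} {z} j j∈I (λ j∈I′ →
            subst (λ e → x (j , e) ≈ᴹ y (j , e) +ᴹ z (j , e)) ([]=-irrelevant j∈I j∈I′) eq)) }
      }
      where
      open MultilinearIn F
      _≟ᴵ_ : DecidableEquality (∃ (_∈ I))
      (i , i∈I) ≟ᴵ (j , j∈I) with i ≟ j
      ... | yes refl = yes (cong (i ,_) ([]=-irrelevant i∈I j∈I))
      ... | no  i≢j  = no (i≢j ∘ cong proj₁)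

  Form : ℕ → Set
  Form k = (Fin k → Carrierᴹ) → F₂

  record Splitting {k} (f : Form k) : Set where
    field
      I           : Subset k
      I-nonempty  : Nonempty I
      ∁I-nonempty : Nonempty (∁ I)
      β γ         : Form k
      β-in        : MultilinearIn (_∈ I) β
      γ-in        : MultilinearIn (_∈ ∁ I) γ
      splits      : ∀ x → f x ≡ β x · γ x

  -- Every constructor carries a pointwise equation, so a form can be replaced by one with the same
  -- values without function extensionality.
  data SumOfSplittings {k} : Form k → ℕ → Set where
    nil  : ∀ {f} → (∀ x → f x ≡ 0ℙ) → SumOfSplittings f 0
    cons : ∀ {f g h s} → Splitting f → SumOfSplittings g s → (∀ x → h x ≡ f x + g x) →
           SumOfSplittings h (suc s)

  module _ {k : ℕ} where

    toDecomposition : ∀ {f : Form k} {s} → SumOfSplittings f s → PartitionDecomposition V f s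
    toDecomposition (nil f≡0) = record
      { I = λ () ; nonempty = λ () ; proper = λ () ; β = λ () ; γ = λ ()
      ; β-multilinear = λ () ; γ-multilinear = λ () ; decomposes = f≡0 }
    toDecomposition (cons {s = s} S G h≡f+g) = record
      { I             = λ { zero → I ; (suc i) → G.I i }
      ; nonempty      = λ { zero → I-nonempty ; (suc i) → G.nonempty i }
      ; proper        = λ { zero → (λ _ → ∈⊤) , proj₁ ∁I-nonempty , ∈⊤ , x∈∁p⇒x∉p (proj₂ ∁I-nonempty)
                          ; (suc i) → G.proper i }
      ; β             = λ { zero → β ∘ extend ; (suc i) → G.β i }
      ; γ             = λ { zero → γ ∘ extend ; (suc i) → G.γ i }
      ; β-multilinear = λ { zero → extend-multilinear β-in ; (suc i) → G.β-multilinear i }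
      ; γ-multilinear = λ { zero → extend-multilinear γ-in ; (suc i) → G.γ-multilinear i }
      ; decomposes    = λ x → trans (h≡f+g x) (cong₂ _+_
          (trans (splits x) (cong₂ _·_ (MultilinearIn.local β-in (extend-restrict x))
                                       (MultilinearIn.local γ-in (extend-restrict x))))
          (G.decomposes x))
      }
      where
      open Splitting S
      module G = PartitionDecomposition (toDecomposition G)

    fromDecomposition : ∀ {f : Form k} {s} → (D : PartitionDecomposition V f s) →
      Σ (Fin s → Form k) λ T → (∀ i → Splitting (T i)) × (∀ x → f x ≡ sum (λ i → T i x))
    fromDecomposition D =
      (λ i x → β i (restrict (I i) x) · γ i (restrict (∁ (I i)) x)) ,
      (λ i → record
        { I = I i ; I-nonempty = nonempty i
        ; ∁I-nonempty = let (_ , j , _ , j∉I) = proper i in j , x∉p⇒x∈∁p j∉I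
        ; β-in = restrict-multilinear (β-multilinear i)
        ; γ-in = restrict-multilinear (γ-multilinear i)
        ; splits = λ _ → refl }) ,
      decomposes
      where open PartitionDecomposition D

    sumOfSplittings : ∀ {s} {T : Fin s → Form k} {f} → (∀ i → Splitting (T i)) →
                      (∀ x → f x ≡ sum (λ i → T i x)) → SumOfSplittings f s
    sumOfSplittings {zero}  S f≡ = nil f≡
    sumOfSplittings {suc s} S f≡ = cons (S zero) (sumOfSplittings (S ∘ suc) (λ _ → refl)) f≡

    ≗-sumOfSplittings : ∀ {f g : Form k} {s} → (∀ x → g x ≡ f x) →
                        SumOfSplittings f s → SumOfSplittings g s
    ≗-sumOfSplittings g≗f (nil f≡0)     = nil (λ x → trans (g≗f x) (f≡0 x))
    ≗-sumOfSplittings g≗f (cons S F f≡) = cons S F (λ x → trans (g≗f x) (f≡ x))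

    PRank≤ : Form k → ℕ → Set
    PRank≤ f r = ∃[ s ] s ≤ r × SumOfSplittings f s

    ++-splittings : ∀ {f g h : Form k} {s t} → SumOfSplittings f s → SumOfSplittings g t →
                    (∀ x → h x ≡ f x + g x) → SumOfSplittings h (s ℕ.+ t)
    ++-splittings (nil f≡0) (nil g≡0) h≡ = nil (λ x → trans (h≡ x) (cong₂ _+_ (f≡0 x) (g≡0 x)))
    ++-splittings (nil f≡0) (cons S G g≡) h≡ =
      cons S G (λ x → trans (h≡ x) (trans (cong (_+ _) (f≡0 x)) (g≡ x)))
    ++-splittings {g = g} (cons {f₁} {f₂} S F f≡) G h≡ = cons S (++-splittings F G (λ _ → refl))
      (λ x → trans (h≡ x) (trans (cong (_+ g x) (f≡ x)) (ℙ.+-assoc (f₁ x) (f₂ x) (g x))))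

    sum-PRank≤ : ∀ {n r} {f : Fin n → Form k} → (∀ i → PRank≤ (f i) r) →
                 PRank≤ (λ x → sum (λ i → f i x)) (n * r)
    sum-PRank≤ {zero}  F = 0 , ℕ.z≤n , nil (λ _ → refl)
    sum-PRank≤ {suc n} F = let (s , s≤ , S) = F zero ; (t , t≤ , T) = sum-PRank≤ (F ∘ suc) in
      s ℕ.+ t , ℕ.+-mono-≤ s≤ t≤ , ++-splittings S T (λ _ → refl)

    *-PRank≤ : ∀ {r} {f : Form k} c → PRank≤ f r → PRank≤ (λ x → c · f x) r
    *-PRank≤ 0ℙ _ = 0 , ℕ.z≤n , nil (λ _ → refl)
    *-PRank≤ 1ℙ F = F

-- Permutations of the first `m` positions and sums over pairs of positions

transpose-fix : ∀ {n} (i j : Fin n) {l} → l ≢ i → l ≢ j → transpose i j ⟨$⟩ʳ l ≡ l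
transpose-fix i j {l} l≢i l≢j with l ≟ i
... | yes l≡i = ⊥-elim (l≢i l≡i)
... | no _ with l ≟ j
...   | yes l≡j = ⊥-elim (l≢j l≡j)
...   | no _    = refl

transpose-left : ∀ {n} (i j : Fin n) → transpose i j ⟨$⟩ʳ i ≡ j
transpose-left i j with i ≟ i
... | yes _   = refl
... | no  i≢i = ⊥-elim (i≢i refl)

⟨$⟩ʳ-injective : ∀ {n} (π : Permutation′ n) {i j} → π ⟨$⟩ʳ i ≡ π ⟨$⟩ʳ j → i ≡ j
⟨$⟩ʳ-injective π eq = trans (sym (Perm.inverseˡ π)) (trans (cong (π ⟨$⟩ˡ_) eq) (Perm.inverseˡ π))

-- In characteristic 2 the off-diagonal entries cancel in pairs.
sum-symmetric : ∀ {n} (g : Fin n → Fin n → F₂) → (∀ p q → g p q ≡ g q p) → (∀ p → g p p ≡ 0ℙ) →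
                sum (λ p → sum (g p)) ≡ 0ℙ
sum-symmetric {zero}  g g-sym g-diag = refl
sum-symmetric {suc n} g g-sym g-diag = begin
  (g zero zero + row) + sum (λ p → g (suc p) zero + sum (λ q → g (suc p) (suc q)))
    ≡⟨ cong₂ _+_ (cong (_+ row) (g-diag zero))
         (∑-distrib-+ (λ p → g (suc p) zero) (λ p → sum (λ q → g (suc p) (suc q)))) ⟩
  row + (sum (λ p → g (suc p) zero) + sum (λ p → sum (λ q → g (suc p) (suc q))))
    ≡⟨ cong₂ (λ s t → row + (s + t)) (sum-cong-≗ (λ p → g-sym (suc p) zero))
         (sum-symmetric (λ p q → g (suc p) (suc q)) (λ p q → g-sym (suc p) (suc q)) (g-diag ∘ suc)) ⟩
  row + (row + 0ℙ)
    ≡⟨ cong (row +_) (ℙ.+-identityʳ row) ⟩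
  row + row
    ≡⟨ ℙ.p+p≡0ℙ row ⟩
  0ℙ ∎
  where
  open ≡-Reasoning
  row = sum (λ q → g zero (suc q))

⟦_⟧ : Bool → F₂
⟦ true  ⟧ = 1ℙ
⟦ false ⟧ = 0ℙ

<ᵇ-true : ∀ {m n} → m < n → (m <ᵇ n) ≡ true
<ᵇ-true {m} {n} m<n with m <ᵇ n | ℕ.<⇒<ᵇ m<n
... | true | _ = refl

<ᵇ-false : ∀ {m n} → ¬ m < n → (m <ᵇ n) ≡ false
<ᵇ-false {m} {n} m≮n with m <ᵇ n in eq
... | false = refl
... | true  = ⊥-elim (m≮n (ℕ.<ᵇ⇒< m n (subst T (sym eq) _)))

-- Turns a sum over pairs `p < q < m` into a full double sum whose weights compute at concrete
-- positions.
⟦_<_<_⟧ : ∀ {k} → Fin k → Fin k → ℕ → F₂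
⟦ p < q < m ⟧ = ⟦ (toℕ p <ᵇ toℕ q) ∧ (toℕ q <ᵇ m) ⟧

module _ {k : ℕ} (m : ℕ) where

  private
    -- The weight of an unordered pair: 1 exactly if `p` and `q` are distinct and both below `m`.
    -- Unlike the ordered weight, it is invariant under permutations of the first `m` positions.
    w : Fin k → Fin k → F₂
    w p q = ⟦ p < q < m ⟧ + ⟦ q < p < m ⟧

    w-diag : ∀ p → w p p ≡ 0ℙ
    w-diag p = ℙ.p+p≡0ℙ ⟦ p < p < m ⟧

    w-comm : ∀ p q → w p q ≡ w q p
    w-comm p q = ℙ.+-comm ⟦ p < q < m ⟧ ⟦ q < p < m ⟧

    w-outside : ∀ {p} q → ¬ toℕ p < m → w p q ≡ 0ℙ
    w-outside {p} q p≮m with toℕ p <ᵇ toℕ q in eq | toℕ q <ᵇ m in eq′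
    ... | true  | true  = ⊥-elim (p≮m (ℕ.<-trans (ℕ.<ᵇ⇒< _ _ (subst T (sym eq) _))
                                                 (ℕ.<ᵇ⇒< _ _ (subst T (sym eq′) _))))
    ... | true  | false rewrite <ᵇ-false p≮m with toℕ q <ᵇ toℕ p
    ...   | true  = refl
    ...   | false = refl
    w-outside {p} q p≮m | false | _ rewrite <ᵇ-false p≮m with toℕ q <ᵇ toℕ p
    ...   | true  = refl
    ...   | false = refl

    w-inside : ∀ {p q} → p ≢ q → toℕ p < m → toℕ q < m → w p q ≡ 1ℙ
    w-inside {p} {q} p≢q p<m q<m rewrite <ᵇ-true p<m | <ᵇ-true q<m with ℕ.<-cmp (toℕ p) (toℕ q)
    ... | tri< p<q _ p≯q rewrite <ᵇ-true p<q | <ᵇ-false p≯q = refl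
    ... | tri≈ _ p≡q _ = ⊥-elim (p≢q (Fin.toℕ-injective p≡q))
    ... | tri> p≮q _ q<p rewrite <ᵇ-false p≮q | <ᵇ-true q<p = refl

  module _ (π : Permutation′ k) (fixes : ∀ j → m ≤ toℕ j → π ⟨$⟩ʳ j ≡ j) where

    -- If the image of `p` were at least `m`, it would be fixed by `π`, and injectivity would make
    -- it equal to `p`.
    preserves-<m : ∀ {p} → toℕ p < m → toℕ (π ⟨$⟩ʳ p) < m
    preserves-<m {p} p<m with toℕ (π ⟨$⟩ʳ p) ℕ.<? m
    ... | yes πp<m = πp<m
    ... | no  πp≮m = subst (λ j → toℕ j < m)
      (sym (⟨$⟩ʳ-injective π (fixes (π ⟨$⟩ʳ p) (ℕ.≮⇒≥ πp≮m)))) p<m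

    preserves-≮m : ∀ {p} → ¬ toℕ p < m → ¬ toℕ (π ⟨$⟩ʳ p) < m
    preserves-≮m {p} p≮m = p≮m ∘ subst (λ j → toℕ j < m) (fixes p (ℕ.≮⇒≥ p≮m))

    private
      w-permute : ∀ p q → w p q ≡ w (π ⟨$⟩ʳ p) (π ⟨$⟩ʳ q)
      w-permute p q with p ≟ q | toℕ p ℕ.<? m | toℕ q ℕ.<? m
      ... | yes refl | _       | _       = trans (w-diag p) (sym (w-diag (π ⟨$⟩ʳ p)))
      ... | no  p≢q  | yes p<m | yes q<m = trans (w-inside p≢q p<m q<m)
        (sym (w-inside (p≢q ∘ ⟨$⟩ʳ-injective π) (preserves-<m p<m) (preserves-<m q<m)))
      ... | no  _    | no  p≮m | _       =
        trans (w-outside q p≮m) (sym (w-outside (π ⟨$⟩ʳ q) (preserves-≮m p≮m)))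
      ... | no  _    | yes _   | no  q≮m = trans (w-comm p q) (trans (w-outside p q≮m)
        (trans (sym (w-outside (π ⟨$⟩ʳ p) (preserves-≮m q≮m))) (w-comm (π ⟨$⟩ʳ q) (π ⟨$⟩ʳ p))))

    -- Reindex the right-hand sum along `π` and add. The entries become the sum of two ordered
    -- weights times `g (π p) (π q)`. Invariance of `w` makes this matrix symmetric, its diagonal is
    -- zero, and so its entries cancel in pairs.
    sum-pairs-permute : ∀ (g : Fin k → Fin k → F₂) → (∀ p q → g p q ≡ g q p) →
      sum (λ p → sum λ q → ⟦ p < q < m ⟧ · g (π ⟨$⟩ʳ p) (π ⟨$⟩ʳ q)) ≡
      sum (λ p → sum λ q → ⟦ p < q < m ⟧ · g p q)
    sum-pairs-permute g g-sym = p+q≡0⇒p≡q (begin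
      sum (λ p → sum (c p)) + sum (λ p → sum λ q → ⟦ p < q < m ⟧ · g p q)
        ≡⟨ cong (sum (λ p → sum (c p)) +_) (trans
             (∑-permute (λ p → sum λ q → ⟦ p < q < m ⟧ · g p q) π)
             (sum-cong-≗ λ p → ∑-permute (λ q → ⟦ π ⟨$⟩ʳ p < q < m ⟧ · g (π ⟨$⟩ʳ p) q) π)) ⟩
      sum (λ p → sum (c p)) + sum (λ p → sum (c′ p))
        ≡⟨ ∑-distrib-+ (λ p → sum (c p)) (λ p → sum (c′ p)) ⟨
      sum (λ p → sum (c p) + sum (c′ p))
        ≡⟨ sum-cong-≗ (λ p → ∑-distrib-+ (c p) (c′ p)) ⟨
      sum (λ p → sum λ q → c p q + c′ p q)
        ≡⟨ sum-symmetric (λ p q → c p q + c′ p q) c+c′-sym c+c′-diag ⟩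
      0ℙ ∎)
      where
      open ≡-Reasoning
      c c′ : Fin k → Fin k → F₂
      c  p q = ⟦ p < q < m ⟧ · g (π ⟨$⟩ʳ p) (π ⟨$⟩ʳ q)
      c′ p q = ⟦ π ⟨$⟩ʳ p < π ⟨$⟩ʳ q < m ⟧ · g (π ⟨$⟩ʳ p) (π ⟨$⟩ʳ q)

      c+c′-diag : ∀ p → c p p + c′ p p ≡ 0ℙ
      c+c′-diag p rewrite <ᵇ-false (ℕ.<-irrefl {toℕ p} refl)
                        | <ᵇ-false (ℕ.<-irrefl {toℕ (π ⟨$⟩ʳ p)} refl) = refl

      regroup : ∀ a b a′ b′ → a + b ≡ a′ + b′ → a + a′ ≡ b + b′
      regroup 0ℙ 0ℙ a′ b′ eq = p+q≡0⇒p≡q (sym eq)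
      regroup 0ℙ 1ℙ 0ℙ 1ℙ _ = refl
      regroup 0ℙ 1ℙ 1ℙ 0ℙ _ = refl
      regroup 1ℙ 0ℙ 0ℙ 1ℙ _ = refl
      regroup 1ℙ 0ℙ 1ℙ 0ℙ _ = refl
      regroup 1ℙ 1ℙ a′ b′ eq = cong (1ℙ +_) (p+q≡0⇒p≡q (sym eq))

      c+c′-sym : ∀ p q → c p q + c′ p q ≡ c q p + c′ q p
      c+c′-sym p q = begin
        c p q + c′ p q
          ≡⟨ ℙ.*-distribʳ-+ (g (π ⟨$⟩ʳ p) (π ⟨$⟩ʳ q)) ⟦ p < q < m ⟧ _ ⟨
        (⟦ p < q < m ⟧ + ⟦ π ⟨$⟩ʳ p < π ⟨$⟩ʳ q < m ⟧) · g (π ⟨$⟩ʳ p) (π ⟨$⟩ʳ q)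
          ≡⟨ cong₂ _·_ (regroup ⟦ p < q < m ⟧ _ _ _ (w-permute p q)) (g-sym (π ⟨$⟩ʳ p) (π ⟨$⟩ʳ q)) ⟩
        (⟦ q < p < m ⟧ + ⟦ π ⟨$⟩ʳ q < π ⟨$⟩ʳ p < m ⟧) · g (π ⟨$⟩ʳ q) (π ⟨$⟩ʳ p)
          ≡⟨ ℙ.*-distribʳ-+ (g (π ⟨$⟩ʳ q) (π ⟨$⟩ʳ p)) ⟦ q < p < m ⟧ _ ⟩
        c q p + c′ q p ∎

-- Symmetrisation

module Update (V : VectorSpace) where
  open LeftModule V
  open Forms V

  infix 6 _[_,_≔_,_]

  -- If p = q, the first assignment prevails.
  _[_,_≔_,_] : ∀ {k} → (Fin k → Carrierᴹ) → Fin k → Fin k → Carrierᴹ → Carrierᴹ → Fin k → Carrierᴹ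
  (x [ p , q ≔ u , v ]) j with j ≟ p | j ≟ q
  ... | yes _ | _     = u
  ... | no  _ | yes _ = v
  ... | no  _ | no  _ = x j

  module _ {k : ℕ} where

    ≔-first : ∀ {x : Fin k → Carrierᴹ} {p q u v} → (x [ p , q ≔ u , v ]) p ≡ u
    ≔-first {p = p} with p ≟ p
    ... | yes _   = refl
    ... | no  p≢p = ⊥-elim (p≢p refl)

    ≔-second : ∀ {x : Fin k → Carrierᴹ} {p q u v} → p ≢ q → (x [ p , q ≔ u , v ]) q ≡ v
    ≔-second {p = p} {q} p≢q with q ≟ p | q ≟ q
    ... | yes q≡p | _       = ⊥-elim (p≢q (sym q≡p))
    ... | no  _   | yes _   = refl
    ... | no  _   | no  q≢q = ⊥-elim (q≢q refl)

    ≔-other : ∀ {x : Fin k → Carrierᴹ} {p q u v j} → j ≢ p → j ≢ q → (x [ p , q ≔ u , v ]) j ≡ x j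
    ≔-other {p = p} {q} {j = j} j≢p j≢q with j ≟ p | j ≟ q
    ... | yes j≡p | _       = ⊥-elim (j≢p j≡p)
    ... | no  _   | yes j≡q = ⊥-elim (j≢q j≡q)
    ... | no  _   | no  _   = refl

    ≔-rel : ∀ {r} (R : Carrierᴹ → Carrierᴹ → Set r) {x y : Fin k → Carrierᴹ} {p q u v u′ v′} j →
            R u u′ → R v v′ → (j ≢ p → j ≢ q → R (x j) (y j)) →
            R ((x [ p , q ≔ u , v ]) j) ((y [ p , q ≔ u′ , v′ ]) j)
    ≔-rel R {p = p} {q} j Ru Rv Rx with j ≟ p | j ≟ q
    ... | yes _   | _       = Ru
    ... | no  _   | yes _   = Rv
    ... | no  j≢p | no  j≢q = Rx j≢p j≢q

    ≔-same : ∀ {x : Fin k → Carrierᴹ} {p q u} j → x p ≈ᴹ u → x q ≈ᴹ u → (x [ p , q ≔ u , u ]) j ≈ᴹ x j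
    ≔-same {p = p} {q} j xₚ≈u x_q≈u with j ≟ p | j ≟ q
    ... | yes refl | _        = ≈ᴹ-sym xₚ≈u
    ... | no  _    | yes refl = ≈ᴹ-sym x_q≈u
    ... | no  _    | no  _    = ≈ᴹ-refl

    ≔-swap : ∀ {x : Fin k → Carrierᴹ} {p q u} j → (x [ p , q ≔ u , u ]) j ≡ (x [ q , p ≔ u , u ]) j
    ≔-swap {p = p} {q} j with j ≟ p | j ≟ q
    ... | yes _ | yes _ = refl
    ... | yes _ | no  _ = refl
    ... | no  _ | yes _ = refl
    ... | no  _ | no  _ = refl

    ≔-permute : ∀ {x : Fin k → Carrierᴹ} (π : Permutation′ k) {p q u v} j →
                (x [ π ⟨$⟩ʳ p , π ⟨$⟩ʳ q ≔ u , v ]) (π ⟨$⟩ʳ j) ≡ ((x ∘ (π ⟨$⟩ʳ_)) [ p , q ≔ u , v ]) j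
    ≔-permute {x} π {p} {q} j with j ≟ p | j ≟ q
    ... | yes refl | _        = ≔-first {x = x} {π ⟨$⟩ʳ p} {π ⟨$⟩ʳ q}
    ... | no  j≢p  | yes refl = ≔-second {x = x} (j≢p ∘ sym ∘ ⟨$⟩ʳ-injective π)
    ... | no  j≢p  | no  j≢q  = ≔-other (j≢p ∘ ⟨$⟩ʳ-injective π) (j≢q ∘ ⟨$⟩ʳ-injective π)

  module _ {k : ℕ} {m : ℕ} {α : Form k} (A : MultilinearIn U α) (α-sym : SymmetricInFirst m α) where
    open MultilinearIn A

    -- The cross terms α(…u…v…) and α(…v…u…) agree by symmetry and cancel in characteristic 2.
    pair-linear : ∀ {p q} → p ≢ q → toℕ p < m → toℕ q < m → ∀ x →
                  IsLinear (λ u → α (x [ p , q ≔ u , u ]))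
    pair-linear {p} {q} p≢q p<m q<m x = record
      { ≈-cong = λ u≈v → local (λ j _ → ≔-rel _≈ᴹ_ j u≈v u≈v (λ _ _ → ≈ᴹ-refl))
      ; +-homo = λ u v → begin
          f (u +ᴹ v) (u +ᴹ v)
            ≡⟨ additiveₚ (u +ᴹ v) ⟩
          f u (u +ᴹ v) + f v (u +ᴹ v)
            ≡⟨ cong₂ _+_ (additive_q u) (additive_q v) ⟩
          (f u u + f u v) + (f v u + f v v)
            ≡⟨ cong (λ s → (f u u + s) + (f v u + f v v)) (swap u v) ⟩
          (f u u + f v u) + (f v u + f v v)
            ≡⟨ cancel (f u u) (f v u) (f v v) ⟩
          f u u + f v v ∎
      }
      where
      open ≡-Reasoning
      f : Carrierᴹ → Carrierᴹ → F₂
      f u v = α (x [ p , q ≔ u , v ])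

      cancel : ∀ a b c → (a + b) + (b + c) ≡ a + c
      cancel 0ℙ 0ℙ c = refl
      cancel 0ℙ 1ℙ 0ℙ = refl
      cancel 0ℙ 1ℙ 1ℙ = refl
      cancel 1ℙ 0ℙ c = refl
      cancel 1ℙ 1ℙ c = refl

      off-p : ∀ {u u′ v} i → i ≢ p → (x [ p , q ≔ u , v ]) i ≈ᴹ (x [ p , q ≔ u′ , v ]) i
      off-p i i≢p with i ≟ p | i ≟ q
      ... | yes i≡p | _     = ⊥-elim (i≢p i≡p)
      ... | no  _   | yes _ = ≈ᴹ-refl
      ... | no  _   | no  _ = ≈ᴹ-refl

      off-q : ∀ {u v v′} i → i ≢ q → (x [ p , q ≔ u , v ]) i ≈ᴹ (x [ p , q ≔ u , v′ ]) i
      off-q i i≢q with i ≟ p | i ≟ q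
      ... | yes _ | _       = ≈ᴹ-refl
      ... | no  _ | yes i≡q = ⊥-elim (i≢q i≡q)
      ... | no  _ | no  _   = ≈ᴹ-refl

      additiveₚ : ∀ w {u v} → f (u +ᴹ v) w ≡ f u w + f v w
      additiveₚ w {u} {v} = additive {p} _ off-p off-p
        (≈ᴹ-reflexive (trans (≔-first {x = x} {p} {q} {u +ᴹ v} {w})
          (sym (cong₂ _+ᴹ_ (≔-first {x = x} {p} {q} {u} {w}) (≔-first {x = x} {p} {q} {v} {w})))))

      additive_q : ∀ w {u v} → f w (u +ᴹ v) ≡ f w u + f w v
      additive_q w {u} {v} = additive {q} _ off-q off-q
        (≈ᴹ-reflexive (trans (≔-second {x = x} {p} {q} {w} {u +ᴹ v} p≢q)
          (sym (cong₂ _+ᴹ_ (≔-second {x = x} {p} {q} {w} {u} p≢q) (≔-second {x = x} {p} {q} {w} {v} p≢q)))))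

      τ = transpose p q

      swap : ∀ u v → f u v ≡ f v u
      swap u v = trans
        (sym (α-sym τ (λ j m≤j → transpose-fix p q
          (λ { refl → ℕ.<⇒≱ p<m m≤j }) (λ { refl → ℕ.<⇒≱ q<m m≤j })) (x [ p , q ≔ u , v ])))
        (local (λ j _ → ≈ᴹ-reflexive (pointwise j)))
        where
        pointwise : ∀ j → (x [ p , q ≔ u , v ]) (τ ⟨$⟩ʳ j) ≡ (x [ p , q ≔ v , u ]) j
        pointwise j with j ≟ p
        ... | yes refl = ≔-second p≢q
        ... | no  j≢p  with j ≟ q
        ...   | yes refl = ≔-first {x = x} {p} {q}
        ...   | no  j≢q  = ≔-other j≢p j≢q

  -- `K` ignores the slots `p` and `q`, so a change of one slot affects only one of the three
  -- factors.
  pairing-multilinear : ∀ {k} {P : Pred (Fin k) 0ℓ} {p q ψ} {K : Form k} → p ≢ q → P p → P q → IsLinear ψ →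
    MultilinearIn (λ j → P j × j ≢ p × j ≢ q) K → MultilinearIn P (λ x → ψ (x p) · (ψ (x q) · K x))
  pairing-multilinear {k} {P} {p} {q} {ψ} {K} p≢q Pp Pq Ψ K-in = record
    { local    = λ x≈y → cong₂ _·_ (≈-cong (x≈y p Pp))
        (cong₂ _·_ (≈-cong (x≈y q Pq)) (MultilinearIn.local K-in (λ j (Pj , _) → x≈y j Pj)))
    ; additive = additive
    }
    where
    open IsLinear Ψ
    open ≡-Reasoning
    f : Form k
    f x = ψ (x p) · (ψ (x q) · K x)

    off-p : ∀ {x y} → (∀ i → i ≢ p → y i ≈ᴹ x i) → f y ≡ ψ (y p) · (ψ (x q) · K x)
    off-p {y = y} y≈x = cong₂ (λ s t → ψ (y p) · (s · t)) (≈-cong (y≈x q (p≢q ∘ sym)))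
      (MultilinearIn.local K-in (λ i (_ , i≢p , _) → y≈x i i≢p))

    off-q : ∀ {x y} → (∀ i → i ≢ q → y i ≈ᴹ x i) → f y ≡ ψ (x p) · (ψ (y q) · K x)
    off-q {x} {y = y} y≈x = cong₂ (λ s t → s · (ψ (y q) · t)) (≈-cong (y≈x p p≢q))
      (MultilinearIn.local K-in (λ i (_ , _ , i≢q) → y≈x i i≢q))

    off-pq : ∀ {x y j} → (∀ i → i ≢ j → y i ≈ᴹ x i) → j ≢ p → j ≢ q →
             f y ≡ ψ (x p) · (ψ (x q) · K y)
    off-pq {x} {y} y≈x j≢p j≢q = cong₂ (λ s t → s · (t · K y))
      (≈-cong (y≈x p (j≢p ∘ sym))) (≈-cong (y≈x q (j≢q ∘ sym)))

    additive : ∀ {j} → P j → ∀ {x y z} → (∀ i → i ≢ j → y i ≈ᴹ x i) → (∀ i → i ≢ j → z i ≈ᴹ x i) →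
               x j ≈ᴹ y j +ᴹ z j → f x ≡ f y + f z
    additive {j} Pj {x} {y} {z} y≈x z≈x eq with j ≟ p | j ≟ q
    ... | yes refl | _ = begin
      ψ (x p) · (ψ (x q) · K x)
        ≡⟨ cong (_· (ψ (x q) · K x)) (trans (≈-cong eq) (+-homo (y p) (z p))) ⟩
      (ψ (y p) + ψ (z p)) · (ψ (x q) · K x)
        ≡⟨ ℙ.*-distribʳ-+ (ψ (x q) · K x) (ψ (y p)) (ψ (z p)) ⟩
      ψ (y p) · (ψ (x q) · K x) + ψ (z p) · (ψ (x q) · K x)
        ≡⟨ cong₂ _+_ (off-p y≈x) (off-p z≈x) ⟨
      f y + f z ∎
    ... | no j≢p | yes refl = begin
      ψ (x p) · (ψ (x q) · K x)
        ≡⟨ cong (λ s → ψ (x p) · (s · K x)) (trans (≈-cong eq) (+-homo (y q) (z q))) ⟩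
      ψ (x p) · ((ψ (y q) + ψ (z q)) · K x)
        ≡⟨ cong (ψ (x p) ·_) (ℙ.*-distribʳ-+ (K x) (ψ (y q)) (ψ (z q))) ⟩
      ψ (x p) · (ψ (y q) · K x + ψ (z q) · K x)
        ≡⟨ ℙ.*-distribˡ-+ (ψ (x p)) (ψ (y q) · K x) (ψ (z q) · K x) ⟩
      ψ (x p) · (ψ (y q) · K x) + ψ (x p) · (ψ (z q) · K x)
        ≡⟨ cong₂ _+_ (off-q y≈x) (off-q z≈x) ⟨
      f y + f z ∎
    ... | no j≢p | no j≢q = begin
      ψ (x p) · (ψ (x q) · K x)
        ≡⟨ cong (λ s → ψ (x p) · (ψ (x q) · s)) (MultilinearIn.additive K-in (Pj , j≢p , j≢q) y≈x z≈x eq) ⟩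
      ψ (x p) · (ψ (x q) · (K y + K z))
        ≡⟨ cong (ψ (x p) ·_) (ℙ.*-distribˡ-+ (ψ (x q)) (K y) (K z)) ⟩
      ψ (x p) · (ψ (x q) · K y + ψ (x q) · K z)
        ≡⟨ ℙ.*-distribˡ-+ (ψ (x p)) (ψ (x q) · K y) (ψ (x q) · K z) ⟩
      ψ (x p) · (ψ (x q) · K y) + ψ (x p) · (ψ (x q) · K z)
        ≡⟨ cong₂ _+_ (off-pq {x} y≈x j≢p j≢q) (off-pq {x} z≈x j≢p j≢q) ⟨
      f y + f z ∎

  update-multilinear : ∀ {k} {f : Form k} → MultilinearIn U f → ∀ p q v →
                       MultilinearIn (λ j → U j × j ≢ p × j ≢ q) (λ x → f (x [ p , q ≔ v , v ]))
  update-multilinear {f = f} F p q v = record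
    { local    = λ x≈y → MultilinearIn.local F (λ j _ →
        ≔-rel _≈ᴹ_ j ≈ᴹ-refl ≈ᴹ-refl (λ j≢p j≢q → x≈y j (_ , j≢p , j≢q)))
    ; additive = λ {j} (_ , j≢p , j≢q) {x} {y} {z} y≈x z≈x eq → MultilinearIn.additive F {j} _
        (λ i i≢j → ≔-rel _≈ᴹ_ i ≈ᴹ-refl ≈ᴹ-refl (λ _ _ → y≈x i i≢j))
        (λ i i≢j → ≔-rel _≈ᴹ_ i ≈ᴹ-refl ≈ᴹ-refl (λ _ _ → z≈x i i≢j))
        (subst₂ _≈ᴹ_ (sym (≔-other {x = x} j≢p j≢q))
          (sym (cong₂ _+ᴹ_ (≔-other {x = y} j≢p j≢q) (≔-other {x = z} j≢p j≢q))) eq)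
    }

-- The correction term `σ` and its partition rank

module Symmetrisation
  (V : VectorSpace) {d} {b : Vector ∣ V ∣ d} (basis : IsBasis V b)
  {k m : ℕ} {α : (Fin (2 ℕ.+ k) → ∣ V ∣) → F₂} (A : Forms.MultilinearIn V U α)
  (α-sym : SymmetricInFirst (2 ℕ.+ m) α)
  where
  open LeftModule V
  open Forms V
  open Update V
  open IsBasis basis
  open ≡-Reasoning

  private
    M K : ℕ
    M = 2 ℕ.+ m
    K = 2 ℕ.+ k

  v+v≈0 : ∀ v → v +ᴹ v ≈ᴹ 0ᴹ
  v+v≈0 v = ≈ᴹ-trans
    (+ᴹ-cong (≈ᴹ-sym (*ₗ-identityˡ v)) (≈ᴹ-sym (*ₗ-identityˡ v)))
    (≈ᴹ-trans (≈ᴹ-sym (*ₗ-distribʳ v 1ℙ 1ℙ)) (*ₗ-zeroˡ v))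

  combination : Vector F₂ d → Carrierᴹ
  combination c = ΣV.sum (λ l → c l *ₗ b l)

  combination-+ : ∀ c c′ → combination (λ l → c l + c′ l) ≈ᴹ combination c +ᴹ combination c′
  combination-+ c c′ = ≈ᴹ-trans (ΣV.sum-cong-≋ (λ l → *ₗ-distribʳ (b l) (c l) (c′ l)))
    (ΣV.∑-distrib-+ (λ l → c l *ₗ b l) (λ l → c′ l *ₗ b l))

  combination-injective : ∀ c c′ → combination c ≈ᴹ combination c′ → ∀ l → c l ≡ c′ l
  combination-injective c c′ eq l = p+q≡0⇒p≡q (independent (λ l → c l + c′ l)
    (≈ᴹ-trans (combination-+ c c′) (≈ᴹ-trans (+ᴹ-congʳ eq) (v+v≈0 _))) l)

  coord : Fin d → Carrierᴹ → F₂
  coord l v = proj₁ (spanning v) l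

  -- `spanning` merely chooses coefficients; independence makes them unique, and uniqueness forces
  -- them to respect equality and sums.
  coord-linear : ∀ l → IsLinear (coord l)
  coord-linear l = record
    { ≈-cong = λ {u} {v} u≈v → combination-injective _ _
        (≈ᴹ-trans (≈ᴹ-sym (proj₂ (spanning u))) (≈ᴹ-trans u≈v (proj₂ (spanning v)))) l
    ; +-homo = λ u v → combination-injective _ (λ l → coord l u + coord l v)
        (≈ᴹ-trans (≈ᴹ-sym (proj₂ (spanning (u +ᴹ v)))) (≈ᴹ-trans
          (+ᴹ-cong (proj₂ (spanning u)) (proj₂ (spanning v)))
          (≈ᴹ-sym (combination-+ (λ l → coord l u) (λ l → coord l v))))) l
    }

  -- The linear map u ↦ α(… u … u …) becomes a symmetric bilinear map in
  -- (x p, x q) whose diagonal is that linear map.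
  pairing : Fin K → Fin K → Form K
  pairing p q x = sum λ l → coord l (x p) · (coord l (x q) · α (x [ p , q ≔ b l , b l ]))

  pairing-in : ∀ {p q} → p ≢ q → MultilinearIn U (pairing p q)
  pairing-in {p} {q} p≢q = sum-multilinear λ l →
    pairing-multilinear {P = U} p≢q _ _ (coord-linear l) (update-multilinear A p q (b l))

  pairing-cong : ∀ p q {x y} → (∀ j → x j ≈ᴹ y j) → pairing p q x ≡ pairing p q y
  pairing-cong p q x≈y = sum-cong-≗ λ l → cong₂ _·_ (≈-cong (coord-linear l) (x≈y p))
    (cong₂ _·_ (≈-cong (coord-linear l) (x≈y q))
      (MultilinearIn.local A (λ j _ → ≔-rel _≈ᴹ_ j ≈ᴹ-refl ≈ᴹ-refl (λ _ _ → x≈y j))))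
    where open IsLinear

  pairing-swap : ∀ p q x → pairing p q x ≡ pairing q p x
  pairing-swap p q x = sum-cong-≗ λ l → begin
    coord l (x p) · (coord l (x q) · α (x [ p , q ≔ b l , b l ]))
      ≡⟨ ℙ.*-assoc (coord l (x p)) _ _ ⟨
    coord l (x p) · coord l (x q) · α (x [ p , q ≔ b l , b l ])
      ≡⟨ cong₂ _·_ (ℙ.*-comm (coord l (x p)) _)
           (MultilinearIn.local A (λ j _ → ≈ᴹ-reflexive (≔-swap {x = x} {p} {q} j))) ⟩
    coord l (x q) · coord l (x p) · α (x [ q , p ≔ b l , b l ])
      ≡⟨ ℙ.*-assoc (coord l (x q)) _ _ ⟩
    coord l (x q) · (coord l (x p) · α (x [ q , p ≔ b l , b l ])) ∎

  pairing-permute : ∀ π → (∀ j → M ≤ toℕ j → π ⟨$⟩ʳ j ≡ j) → ∀ p q x →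
                    pairing p q (x ∘ (π ⟨$⟩ʳ_)) ≡ pairing (π ⟨$⟩ʳ p) (π ⟨$⟩ʳ q) x
  pairing-permute π fixes p q x = sum-cong-≗ λ l →
    cong (λ s → coord l (x (π ⟨$⟩ʳ p)) · (coord l (x (π ⟨$⟩ʳ q)) · s))
      (trans (MultilinearIn.local A (λ j _ → ≈ᴹ-reflexive (sym (≔-permute {x = x} π {p} {q} j))))
             (α-sym π fixes (x [ π ⟨$⟩ʳ p , π ⟨$⟩ʳ q ≔ b l , b l ])))

  -- Write `d` for the common value of `x p` and `x q`. Coordinates are idempotent in F₂, so only
  -- one factor `coord l d` remains, and `pair-linear` reassembles the values at the basis vectors
  -- into the value at `d`.
  pairing-collapse : ∀ {p q} → p ≢ q → toℕ p < M → toℕ q < M → ∀ {x} → x p ≈ᴹ x q →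
                     pairing p q x ≡ α x
  pairing-collapse {p} {q} p≢q p<M q<M {x} xₚ≈x_q = begin
    pairing p q x
      ≡⟨ sum-cong-≗ (λ l → trans (sym (ℙ.*-assoc (coord l (x p)) _ _)) (cong (_· α (x [ p , q ≔ b l , b l ]))
           (trans (cong (coord l (x p) ·_) (sym (≈-cong (coord-linear l) xₚ≈x_q))) (ℙ.*-idem _)))) ⟩
    sum (λ l → coord l (x p) · α (x [ p , q ≔ b l , b l ]))
      ≡⟨ sum-homo ψ (λ l → coord l (x p)) b ⟨
    α (x [ p , q ≔ combination (λ l → coord l (x p)) , combination (λ l → coord l (x p)) ])
      ≡⟨ ≈-cong ψ (proj₂ (spanning (x p))) ⟨
    α (x [ p , q ≔ x p , x p ])
      ≡⟨ MultilinearIn.local A (λ j _ → ≔-same {x = x} {p} {q} j ≈ᴹ-refl (≈ᴹ-sym xₚ≈x_q)) ⟩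
    α x ∎
    where
    open IsLinear
    ψ = pair-linear A α-sym p≢q p<M q<M x

  σ : Form K
  σ x = sum λ p → sum λ q → ⟦ p < q < M ⟧ · pairing p q x

  σ-in : MultilinearIn U σ
  σ-in = sum-multilinear λ p → sum-multilinear λ q → term p q
    where
    term : ∀ p q → MultilinearIn U (λ x → ⟦ p < q < M ⟧ · pairing p q x)
    term p q with p ≟ q
    ... | no  p≢q  = *-multilinear ⟦ p < q < M ⟧ (pairing-in p≢q)
    -- For `p = q` the pairing is quadratic in the shared slot, but its weight is 0.
    ... | yes refl rewrite <ᵇ-false (ℕ.<-irrefl {toℕ p} refl) = 0-multilinear

  σ-sym : SymmetricInFirst M σ
  σ-sym π fixes x = trans
    (sum-cong-≗ λ p → sum-cong-≗ λ q → cong (⟦ p < q < M ⟧ ·_) (pairing-permute π fixes p q x))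
    (sum-pairs-permute M π fixes (λ p q → pairing p q x) (λ p q → pairing-swap p q x))

  -- The condition under which the pairs avoiding positions 0 and 1 drop out of `σ` on the diagonal.
  -- The indices `p` and `q` count from position 2.
  Degenerate : Set
  Degenerate = ∀ (p q : Fin k) x → toℕ p < toℕ q → toℕ q < m →
               x zero ≈ᴹ x (suc zero) → x (suc (suc p)) ≈ᴹ x (suc (suc q)) → α x ≡ 0ℙ

  σ-diagonal : Degenerate → ∀ x → x zero ≈ᴹ x (suc zero) → σ x ≡ α x
  σ-diagonal degenerate x x₀≈x₁ = begin
    -- Splitting off the first two rows and columns is a computation: of the four weights in the
    -- corner only that of (0, 1) is 1, and the weights below the corner reduce to 0.
    (pairing zero (suc zero) x + A₀) + (A₁ + R)
      ≡⟨ cong (λ s → (s + A₀) + (A₁ + R)) (pairing-collapse (λ ()) (s≤s z≤n) (s≤s (s≤s z≤n)) x₀≈x₁) ⟩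
    (α x + A₀) + (A₁ + R)
      ≡⟨ cong₂ (λ s t → (α x + s) + (A₁ + t)) A₀≡A₁ R≡0 ⟩
    (α x + A₁) + (A₁ + 0ℙ)
      ≡⟨ cong ((α x + A₁) +_) (ℙ.+-identityʳ A₁) ⟩
    (α x + A₁) + A₁
      ≡⟨ trans (ℙ.+-assoc (α x) A₁ A₁) (trans (cong (α x +_) (ℙ.p+p≡0ℙ A₁)) (ℙ.+-identityʳ (α x))) ⟩
    α x ∎
    where
    A₀ A₁ R : F₂
    A₀ = sum λ q → ⟦ zero {1 ℕ.+ k} < suc (suc q) < M ⟧ · pairing zero (suc (suc q)) x
    A₁ = sum λ q → ⟦ suc (zero {k}) < suc (suc q) < M ⟧ · pairing (suc zero) (suc (suc q)) x
    R  = sum λ p → sum λ q → ⟦ suc (suc p) < suc (suc q) < M ⟧ · pairing (suc (suc p)) (suc (suc q)) x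

    τ : Permutation′ K
    τ = transpose zero (suc zero)

    x∘τ≈x : ∀ j → x j ≈ᴹ x (τ ⟨$⟩ʳ j)
    x∘τ≈x zero          = x₀≈x₁
    x∘τ≈x (suc zero)    = ≈ᴹ-sym x₀≈x₁
    x∘τ≈x (suc (suc j)) = ≈ᴹ-refl

    A₀≡A₁ : A₀ ≡ A₁
    -- Exchanging positions 0 and 1 leaves `x` unchanged up to `≈ᴹ` and carries the pair (0, q) to
    -- (1, q); the two weights compute to the same value.
    A₀≡A₁ = sum-cong-≗ λ q → cong (⟦ zero {1 ℕ.+ k} < suc (suc q) < M ⟧ ·_) (trans
      (pairing-cong zero (suc (suc q)) x∘τ≈x)
      (pairing-permute τ (λ { zero () ; (suc zero) (s≤s ()) ; (suc (suc j)) _ → refl }) zero (suc (suc q)) x))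

    R≡0 : R ≡ 0ℙ
    R≡0 = sum-zero λ p → sum-zero λ q → vanish p q
      where
      vanish : ∀ p q → ⟦ suc (suc p) < suc (suc q) < M ⟧ · pairing (suc (suc p)) (suc (suc q)) x ≡ 0ℙ
      vanish p q with toℕ p <ᵇ toℕ q in p<q | toℕ q <ᵇ m in q<m
      ... | false | _     = refl
      ... | true  | false = refl
      -- Each summand evaluates `α` at a tuple with equal entries 0 and 1 and with `b l` in both
      -- positions of the pair.
      ... | true  | true  = sum-zero λ l → trans
        (cong (λ s → coord l (x (suc (suc p))) · (coord l (x (suc (suc q))) · s))
          (degenerate p q (x [ suc (suc p) , suc (suc q) ≔ b l , b l ])
            p<q′ (ℕ.<ᵇ⇒< _ _ (subst T (sym q<m) _)) x₀≈x₁
            (≈ᴹ-reflexive (trans (≔-first {x = x} {suc (suc p)} {suc (suc q)})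
              (sym (≔-second {x = x} (p≢q ∘ Fin.suc-injective ∘ Fin.suc-injective)))))))
        (trans (cong (coord l (x (suc (suc p))) ·_) (ℙ.*-zeroʳ (coord l (x (suc (suc q)))))) (ℙ.*-zeroʳ _))
        where
        p<q′ = ℕ.<ᵇ⇒< (toℕ p) (toℕ q) (subst T (sym p<q) _)
        p≢q : p ≢ q
        p≢q refl = ℕ.<-irrefl refl p<q′

  skip₁ : ∀ {n} → Fin (suc n) → Fin (2 ℕ.+ n)
  skip₁ zero    = zero
  skip₁ (suc j) = suc (suc j)

  pinch-skip₁ : ∀ {n} (j : Fin (suc n)) → pinch zero (skip₁ j) ≡ j
  pinch-skip₁ zero    = refl
  pinch-skip₁ (suc j) = refl

  skip₁-pinch : ∀ {n} (j : Fin (2 ℕ.+ n)) → j ≢ suc zero → skip₁ (pinch zero j) ≡ j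
  skip₁-pinch zero          _   = refl
  skip₁-pinch (suc zero)    j≢1 = ⊥-elim (j≢1 refl)
  skip₁-pinch (suc (suc j)) _   = refl

  module PairingRank (ρ : Permutation′ K) where

    p q : Fin K
    p = ρ ⟨$⟩ʳ zero
    q = ρ ⟨$⟩ʳ suc zero

    -- The variables p and q of α both become variable 0 of the diagonal.
    collapse : Fin K → Fin (suc k)
    collapse j = pinch zero (ρ ⟨$⟩ˡ j)

    section : Fin (suc k) → Fin K
    section j = ρ ⟨$⟩ʳ skip₁ j

    collapse-p : collapse p ≡ zero
    collapse-p = cong (pinch zero) (Perm.inverseˡ ρ)

    collapse-q : collapse q ≡ zero
    collapse-q = cong (pinch zero) (Perm.inverseˡ ρ)

    collapse-section : ∀ j → collapse (section j) ≡ j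
    collapse-section j = trans (cong (pinch zero) (Perm.inverseˡ ρ)) (pinch-skip₁ j)

    section-collapse : ∀ {j} → j ≢ q → section (collapse j) ≡ j
    section-collapse {j} j≢q = trans
      (cong (ρ ⟨$⟩ʳ_) (skip₁-pinch (ρ ⟨$⟩ˡ j) (λ eq → j≢q (trans (sym (Perm.inverseʳ ρ)) (cong (ρ ⟨$⟩ʳ_) eq)))))
      (Perm.inverseʳ ρ)

    p≢q : p ≢ q
    p≢q eq with ⟨$⟩ʳ-injective ρ eq
    ... | ()

    -- `section` sends variable 0 to `p`, so the merged variable receives `v`; the others are read
    -- from `x`.
    plug : Carrierᴹ → Form (suc k) → Form K
    plug v f x = f ((x [ p , q ≔ v , v ]) ∘ section)

    plug-in : ∀ {P : Pred (Fin (suc k)) 0ℓ} {f} v → MultilinearIn P f →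
              MultilinearIn (λ j → P (collapse j) × j ≢ p × j ≢ q) (plug v f)
    plug-in {P} v F = record
      { local    = λ x≈y → MultilinearIn.local F λ i Pi → ≔-rel _≈ᴹ_ (section i) ≈ᴹ-refl ≈ᴹ-refl
          (λ ≢p ≢q → x≈y (section i) (subst P (sym (collapse-section i)) Pi , ≢p , ≢q))
      ; additive = λ {j} (Pj , j≢p , j≢q) {x} {y} {z} y≈x z≈x eq → MultilinearIn.additive F Pj
          (λ i i≢ → ≔-rel _≈ᴹ_ (section i) ≈ᴹ-refl ≈ᴹ-refl (λ _ _ → y≈x (section i) (section≢ i≢)))
          (λ i i≢ → ≔-rel _≈ᴹ_ (section i) ≈ᴹ-refl ≈ᴹ-refl (λ _ _ → z≈x (section i) (section≢ i≢)))
          (subst (λ i → (x [ p , q ≔ v , v ]) i ≈ᴹ (y [ p , q ≔ v , v ]) i +ᴹ (z [ p , q ≔ v , v ]) i)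
            (sym (section-collapse j≢q))
            (subst₂ _≈ᴹ_ (sym (≔-other {x = x} j≢p j≢q))
              (sym (cong₂ _+ᴹ_ (≔-other {x = y} j≢p j≢q) (≔-other {x = z} j≢p j≢q))) eq))
      }
      where
      section≢ : ∀ {i j} → i ≢ collapse j → section i ≢ j
      section≢ i≢ refl = i≢ (sym (collapse-section _))

    -- The pairing construction for an arbitrary form in the merged variables. It is additive in `f`
    -- and compatible with products, so a decomposition of the diagonal of `α` can be carried over
    -- term by term.
    lift : Form (suc k) → Form K
    lift f x = sum λ l → coord l (x p) · (coord l (x q) · plug (b l) f x)

    lift-in : ∀ {P : Pred (Fin (suc k)) 0ℓ} {f} → P zero → MultilinearIn P f →
              MultilinearIn (P ∘ collapse) (lift f)
    lift-in {P} P0 F = sum-multilinear λ l → pairing-multilinear p≢q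
      (subst P (sym collapse-p) P0) (subst P (sym collapse-q) P0) (coord-linear l) (plug-in (b l) F)

    -- No variable satisfying `P` collapses to 0, so the conditions excluding `p` and `q` hold
    -- automatically; `0ᴹ` is a default that `f` does not see.
    plug-0-in : ∀ {P : Pred (Fin (suc k)) 0ℓ} {f} → ¬ P zero → MultilinearIn P f →
                MultilinearIn (P ∘ collapse) (plug 0ᴹ f)
    plug-0-in {P} ¬P0 F = ⇔-multilinear proj₁
      (λ Pj → Pj , (λ { refl → ¬P0 (subst P collapse-p Pj) }) , (λ { refl → ¬P0 (subst P collapse-q Pj) }))
      (plug-in 0ᴹ F)

    plug-constant : ∀ {P : Pred (Fin (suc k)) 0ℓ} {f} → ¬ P zero → MultilinearIn P f →
                    ∀ u v x → plug u f x ≡ plug v f x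
    plug-constant {P} ¬P0 F u v x = MultilinearIn.local F λ i Pi → ≈ᴹ-reflexive (trans
      (≔-other {x = x} (≢p Pi) (≢q Pi)) (sym (≔-other {x = x} (≢p Pi) (≢q Pi))))
      where
      ≢p : ∀ {i} → P i → section i ≢ p
      ≢p {i} Pi eq = ¬P0 (subst P (trans (sym (collapse-section i)) (trans (cong collapse eq) collapse-p)) Pi)
      ≢q : ∀ {i} → P i → section i ≢ q
      ≢q {i} Pi eq = ¬P0 (subst P (trans (sym (collapse-section i)) (trans (cong collapse eq) collapse-q)) Pi)

    -- The factor `g` ignores variable 0, hence does not vary with `l` and leaves the sum. The
    -- coordinates of `x p` and `x q` stay with `f`.
    lift-· : ∀ {Q : Pred (Fin (suc k)) 0ℓ} {f g} → ¬ Q zero → MultilinearIn Q g →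
             ∀ x → lift (λ y → f y · g y) x ≡ lift f x · plug 0ᴹ g x
    lift-· {f = f} {g} ¬Q0 G x = begin
      sum (λ l → coord l (x p) · (coord l (x q) · (plug (b l) f x · plug (b l) g x)))
        ≡⟨ sum-cong-≗ (λ l → trans
             (cong (λ s → coord l (x p) · (coord l (x q) · (plug (b l) f x · s))) (plug-constant ¬Q0 G (b l) 0ᴹ x))
             (sym (trans (ℙ.*-assoc (coord l (x p)) _ g₀)
               (cong (coord l (x p) ·_) (ℙ.*-assoc (coord l (x q)) _ g₀))))) ⟩
      sum (λ l → coord l (x p) · (coord l (x q) · plug (b l) f x) · g₀)
        ≡⟨ *-distribʳ-sum g₀ (λ l → coord l (x p) · (coord l (x q) · plug (b l) f x)) ⟨
      lift f x · g₀ ∎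
      where g₀ = plug 0ᴹ g x

    lift-cong : ∀ {f g} → (∀ y → f y ≡ g y) → ∀ x → lift f x ≡ lift g x
    lift-cong f≗g x = sum-cong-≗ λ l → cong (λ s → coord l (x p) · (coord l (x q) · s)) (f≗g _)

    lift-+ : ∀ f g x → lift (λ y → f y + g y) x ≡ lift f x + lift g x
    lift-+ f g x = trans
      (sum-cong-≗ λ l → trans (cong (coord l (x p) ·_) (ℙ.*-distribˡ-+ (coord l (x q)) _ _))
                              (ℙ.*-distribˡ-+ (coord l (x p)) _ _))
      (∑-distrib-+ (λ l → coord l (x p) · (coord l (x q) · plug (b l) f x))
                   (λ l → coord l (x p) · (coord l (x q) · plug (b l) g x)))

    lift-0 : ∀ x → lift (const 0ℙ) x ≡ 0ℙ
    lift-0 x = sum-zero λ l → trans (cong (coord l (x p) ·_) (ℙ.*-zeroʳ (coord l (x q)))) (ℙ.*-zeroʳ _)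

    preimage : Subset (suc k) → Subset K
    preimage I = tabulate (lookup I ∘ collapse)

    ∈-preimage⁺ : ∀ {I j} → collapse j ∈ I → j ∈ preimage I
    ∈-preimage⁺ {I} {j} ∈I = lookup⇒[]= j _ (trans (lookup∘tabulate (lookup I ∘ collapse) j) ([]=⇒lookup ∈I))

    ∈-preimage⁻ : ∀ {I j} → j ∈ preimage I → collapse j ∈ I
    ∈-preimage⁻ {I} {j} j∈ = lookup⇒[]= (collapse j) I
      (trans (sym (lookup∘tabulate (lookup I ∘ collapse) j)) ([]=⇒lookup j∈))

    ∈-∁preimage⁺ : ∀ {I j} → collapse j ∈ ∁ I → j ∈ ∁ (preimage I)
    ∈-∁preimage⁺ ∈∁I = x∉p⇒x∈∁p (x∈∁p⇒x∉p ∈∁I ∘ ∈-preimage⁻)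

    ∈-∁preimage⁻ : ∀ {I j} → j ∈ ∁ (preimage I) → collapse j ∈ ∁ I
    ∈-∁preimage⁻ j∈ = x∉p⇒x∈∁p (x∈∁p⇒x∉p j∈ ∘ ∈-preimage⁺)

    -- The side containing variable 0 absorbs both new slots and is lifted; the other side is only
    -- reindexed. Both sides stay nonempty because `section` provides preimages under `collapse`.
    lift-splitting : ∀ {f} → Splitting f → Splitting (lift f)
    lift-splitting {f} S with zero ∈? Splitting.I S
    ... | yes 0∈I = record
      { I           = preimage I
      ; I-nonempty  = section (proj₁ I-nonempty) ,
          ∈-preimage⁺ (subst (_∈ I) (sym (collapse-section _)) (proj₂ I-nonempty))
      ; ∁I-nonempty = section (proj₁ ∁I-nonempty) ,
          ∈-∁preimage⁺ (subst (_∈ ∁ I) (sym (collapse-section _)) (proj₂ ∁I-nonempty))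
      ; β           = lift β
      ; γ           = plug 0ᴹ γ
      ; β-in        = ⇔-multilinear ∈-preimage⁺ ∈-preimage⁻ (lift-in {P = _∈ I} 0∈I β-in)
      ; γ-in        = ⇔-multilinear ∈-∁preimage⁺ ∈-∁preimage⁻
          (plug-0-in {P = _∈ ∁ I} (λ 0∈∁I → x∈∁p⇒x∉p 0∈∁I 0∈I) γ-in)
      ; splits      = λ x → trans (lift-cong splits x)
          (lift-· {Q = _∈ ∁ I} {β} {γ} (λ 0∈∁I → x∈∁p⇒x∉p 0∈∁I 0∈I) γ-in x)
      }
      where open Splitting S
    ... | no 0∉I = record
      { I           = preimage I
      ; I-nonempty  = section (proj₁ I-nonempty) ,
          ∈-preimage⁺ (subst (_∈ I) (sym (collapse-section _)) (proj₂ I-nonempty))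
      ; ∁I-nonempty = section (proj₁ ∁I-nonempty) ,
          ∈-∁preimage⁺ (subst (_∈ ∁ I) (sym (collapse-section _)) (proj₂ ∁I-nonempty))
      ; β           = plug 0ᴹ β
      ; γ           = lift γ
      ; β-in        = ⇔-multilinear ∈-preimage⁺ ∈-preimage⁻ (plug-0-in {P = _∈ I} 0∉I β-in)
      ; γ-in        = ⇔-multilinear ∈-∁preimage⁺ ∈-∁preimage⁻
          (lift-in {P = _∈ ∁ I} (x∉p⇒x∈∁p 0∉I) γ-in)
      ; splits      = λ x → trans (lift-cong (λ y → trans (splits y) (ℙ.*-comm (β y) (γ y))) x)
          (trans (lift-· {Q = _∈ I} {γ} {β} 0∉I β-in x) (ℙ.*-comm (lift γ x) (plug 0ᴹ β x)))
      }
      where open Splitting S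

    lift-sumOfSplittings : ∀ {f s} → SumOfSplittings f s → SumOfSplittings (lift f) s
    lift-sumOfSplittings (nil f≡0) = nil (λ x → trans (lift-cong f≡0 x) (lift-0 x))
    lift-sumOfSplittings (cons {f} {g} S G h≡f+g) =
      cons (lift-splitting S) (lift-sumOfSplittings G) (λ x → trans (lift-cong h≡f+g x) (lift-+ f g x))

    -- By symmetry `ρ` moves the two copies of `b l` into positions 0 and 1, where having equal
    -- entries means that the tuple factors through `pinch zero`.
    pairing≡lift : (∀ j → M ≤ toℕ j → ρ ⟨$⟩ʳ j ≡ j) →
                   ∀ x → pairing p q x ≡ lift (λ y → α (y ∘ pinch zero)) x
    pairing≡lift fixes x = sum-cong-≗ λ l → cong (λ s → coord l (x p) · (coord l (x q) · s)) (trans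
      (sym (α-sym ρ fixes (x [ p , q ≔ b l , b l ])))
      (MultilinearIn.local A (λ { zero _          → ≈ᴹ-refl
                                ; (suc zero) _    → ≈ᴹ-reflexive (trans (≔-second {x = x} p≢q)
                                                      (sym (≔-first {x = x} {p} {q} {b l} {b l})))
                                ; (suc (suc j)) _ → ≈ᴹ-refl })))

  private
    -- A permutation with 0 ↦ p and 1 ↦ q, for p < q.
    placing : Fin K → Fin K → Permutation′ K
    placing p q = transpose (suc zero) q ∘ₚ transpose zero p

  pairing-PRank≤ : ∀ {r} → PRank≤ (λ y → α (y ∘ pinch zero)) r →
                   ∀ p q → toℕ p < toℕ q → toℕ q < M → PRank≤ (pairing p q) r
  -- With the second position a successor, the image of 0 under `placing` reduces to `p` by
  -- computation.
  pairing-PRank≤ (s , s≤r , S) p (suc q) p<q q<M =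
    s , s≤r , (≗-sumOfSplittings eq (lift-sumOfSplittings S))
    where
    ρ = placing p (suc q)
    open PairingRank ρ hiding (p; q)
    ρ1≡q : ρ ⟨$⟩ʳ suc zero ≡ suc q
    ρ1≡q = trans (cong (transpose zero p ⟨$⟩ʳ_) (transpose-left (suc zero) (suc q)))
      (transpose-fix zero p (λ ()) (λ { refl → ℕ.<-irrefl refl p<q }))
    fixes : ∀ j → M ≤ toℕ j → ρ ⟨$⟩ʳ j ≡ j
    fixes j M≤j = trans
      (cong (transpose zero p ⟨$⟩ʳ_) (transpose-fix (suc zero) (suc q) {j}
        (λ { refl → ℕ.<⇒≱ (s≤s (s≤s z≤n)) M≤j }) (λ { refl → ℕ.<⇒≱ q<M M≤j })))
      (transpose-fix zero p {j} (λ { refl → ℕ.<⇒≱ (s≤s z≤n) M≤j }) (λ { refl → ℕ.<⇒≱ (ℕ.<-trans p<q q<M) M≤j }))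
    eq : ∀ x → pairing p (suc q) x ≡ lift (λ y → α (y ∘ pinch zero)) x
    eq x = trans (cong (λ q → pairing p q x) (sym ρ1≡q)) (pairing≡lift fixes x)

  σ-PRank≤ : ∀ {r} → PRank≤ (λ y → α (y ∘ pinch zero)) r → PRank≤ σ (K * (K * r))
  σ-PRank≤ {r} R = sum-PRank≤ λ p → sum-PRank≤ λ q → term p q
    where
    term : ∀ p q → PRank≤ (λ x → ⟦ p < q < M ⟧ · pairing p q x) r
    term p q with toℕ p <ᵇ toℕ q in p<q | toℕ q <ᵇ M in q<M
    ... | false | _     = 0 , z≤n , nil (λ _ → refl)
    ... | true  | false = 0 , z≤n , nil (λ _ → refl)
    ... | true  | true  = pairing-PRank≤ R p q
      (ℕ.<ᵇ⇒< (toℕ p) _ (subst T (sym p<q) _)) (ℕ.<ᵇ⇒< (toℕ q) M (subst T (sym q<M) _))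

-- Subspaces cut out by linear forms

≢1⇒≡0 : ∀ {p : F₂} → p ≢ 1ℙ → p ≡ 0ℙ
≢1⇒≡0 {0ℙ} _   = refl
≢1⇒≡0 {1ℙ} p≢1 = ⊥-elim (p≢1 refl)

module Kernels (V : VectorSpace) where
  open LeftModule V
  open Forms V

  LinearForm : Set
  LinearForm = ∃ IsLinear

  Kernel : List LinearForm → Pred Carrierᴹ 0ℓ
  Kernel L v = All (λ ℓ → proj₁ ℓ v ≡ 0ℙ) L

  kernel : List LinearForm → Subspace V
  kernel L = record
    { Member   = Kernel L
    ; resp     = λ u≈v → All.map (λ { {_ , Ψ} ψu≡0 → trans (sym (≈-cong Ψ u≈v)) ψu≡0 })
    ; 0-closed = All.universal (λ { (_ , Ψ) → 0-homo Ψ }) L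
    ; +-closed = λ { {u} {v} u∈ v∈ → All.zipWith
        (λ { {_ , Ψ} (ψu≡0 , ψv≡0) → trans (+-homo Ψ u v) (cong₂ _+_ ψu≡0 ψv≡0) }) (u∈ , v∈) }
    ; *-closed = λ { c {v} → All.map
        (λ { {_ , Ψ} ψv≡0 → trans (*-homo Ψ c v) (trans (cong (c ·_) ψv≡0) (ℙ.*-zeroʳ c)) }) }
    }
    where open IsLinear

  -- The basis vectors stay in `V`, so `P` can be cut down by one linear form after another;
  -- `space-basis` passes to the subspace at the end.
  record BasisOf (P : Pred Carrierᴹ 0ℓ) (d : ℕ) : Set where
    field
      b           : Vector Carrierᴹ d
      b∈          : ∀ i → P (b i)
      spanning    : ∀ v → P v → Σ (Vector F₂ d) λ c → v ≈ᴹ ΣV.sum (λ i → c i *ₗ b i)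
      independent : ∀ (c : Vector F₂ d) → ΣV.sum (λ i → c i *ₗ b i) ≈ᴹ 0ᴹ → ∀ i → c i ≡ 0ℙ

  sum-*ₗ : ∀ {d} (c : Vector F₂ d) v → ΣV.sum (λ i → c i *ₗ v) ≈ᴹ sum c *ₗ v
  sum-*ₗ {zero}  c v = ≈ᴹ-sym (*ₗ-zeroˡ v)
  sum-*ₗ {suc d} c v = ≈ᴹ-trans (+ᴹ-congˡ (sum-*ₗ (c ∘ suc) v)) (≈ᴹ-sym (*ₗ-distribʳ v (c zero) _))

  module Elimination {P : Pred Carrierᴹ 0ℓ} {d} (B : BasisOf P (suc d)) {ψ} (Ψ : IsLinear ψ)
                     (i : Fin (suc d)) (ψbᵢ≡1 : ψ (BasisOf.b B i) ≡ 1ℙ) where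
    open BasisOf B
    open IsLinear Ψ

    -- One step of Gaussian elimination: the pivot `b i` corrects the other basis vectors so that
    -- they lie in the kernel of `ψ`.
    b′ : Vector Carrierᴹ d
    b′ j = b (punchIn i j) +ᴹ ψ (b (punchIn i j)) *ₗ b i

    ψ-coefficient : Vector F₂ d → F₂
    ψ-coefficient c = sum (λ j → c j · ψ (b (punchIn i j)))

    combination-b′ : ∀ (c : Vector F₂ d) → ΣV.sum (λ j → c j *ₗ b′ j) ≈ᴹ
                           ψ-coefficient c *ₗ b i +ᴹ ΣV.sum (λ j → c j *ₗ b (punchIn i j))
    combination-b′ c = ≈ᴹ-trans
      (ΣV.sum-cong-≋ (λ j → ≈ᴹ-trans (*ₗ-distribˡ (c j) _ _) (≈ᴹ-trans (+ᴹ-comm _ _)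
        (+ᴹ-congʳ (≈ᴹ-sym (*ₗ-assoc (c j) _ (b i)))))))
      (≈ᴹ-trans
        (ΣV.∑-distrib-+ (λ j → (c j · ψ (b (punchIn i j))) *ₗ b i) (λ j → c j *ₗ b (punchIn i j)))
        (+ᴹ-congʳ (sum-*ₗ (λ j → c j · ψ (b (punchIn i j))) (b i))))

    combination-b : ∀ (c : Vector F₂ (suc d)) → ΣV.sum (λ l → c l *ₗ b l) ≈ᴹ
                          c i *ₗ b i +ᴹ ΣV.sum (λ j → c (punchIn i j) *ₗ b (punchIn i j))
    combination-b c = ΣV.sum-remove (λ l → c l *ₗ b l)

    ψ-combination : ∀ (c : Vector F₂ (suc d)) → ψ (ΣV.sum (λ l → c l *ₗ b l)) ≡ c i + ψ-coefficient (c ∘ punchIn i)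
    ψ-combination c = trans (sum-homo c b) (trans (sum-remove (λ l → c l · ψ (b l)))
      (cong (_+ ψ-coefficient (c ∘ punchIn i)) (trans (cong (c i ·_) ψbᵢ≡1) (ℙ.*-identityʳ (c i)))))

    kernelBasis : (∀ {u v} → P u → P v → P (u +ᴹ v)) → (∀ c {v} → P v → P (c *ₗ v)) →
                  BasisOf (λ v → P v × ψ v ≡ 0ℙ) d
    kernelBasis +-closed *-closed = record
      { b = b′
      ; b∈ = λ j → let w = b (punchIn i j) in
          +-closed (b∈ _) (*-closed (ψ w) (b∈ i)) ,
          trans (+-homo w (ψ w *ₗ b i)) (trans
            (cong (ψ w +_) (trans (*-homo (ψ w) (b i)) (trans (cong (ψ w ·_) ψbᵢ≡1) (ℙ.*-identityʳ (ψ w)))))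
            (ℙ.p+p≡0ℙ (ψ w)))
      ; spanning = λ { v (Pv , ψv≡0) →
          let (c , v≈) = spanning v Pv
              -- Vanishing of `ψ` at `v` determines the pivot coefficient from the remaining ones.
              cᵢ≡ : c i ≡ ψ-coefficient (c ∘ punchIn i)
              cᵢ≡ = p+q≡0⇒p≡q (trans (sym (trans (≈-cong v≈) (ψ-combination c))) ψv≡0)
          in c ∘ punchIn i , ≈ᴹ-trans v≈ (≈ᴹ-trans (combination-b c) (≈ᴹ-trans
               (+ᴹ-congʳ (*ₗ-congʳ cᵢ≡)) (≈ᴹ-sym (combination-b′ (c ∘ punchIn i))))) }
      ; independent = λ c eq j →
          -- A relation among the corrected vectors becomes one among the original basis once the
          -- accumulated pivot coefficient is inserted at `i`.
          let ĉ = insertAt c i (ψ-coefficient c)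
          in trans (sym (insertAt-punchIn c i (ψ-coefficient c) j)) (independent ĉ
               (≈ᴹ-trans (combination-b ĉ) (≈ᴹ-trans
                 (+ᴹ-cong (*ₗ-congʳ (insertAt-lookup c i (ψ-coefficient c)))
                          (ΣV.sum-cong-≋ (λ j → *ₗ-congʳ (insertAt-punchIn c i (ψ-coefficient c) j))))
                 (≈ᴹ-trans (≈ᴹ-sym (combination-b′ c)) eq))) (punchIn i j))
      }

  -- A basis vector with `ψ` equal to 1 serves as pivot and lowers the dimension by 1. If there is
  -- none, the basis already lies in the kernel. The drop is recorded exactly because a codimension
  -- is an exact number.
  kernelBasis : ∀ {P d} → BasisOf P d → ∀ {ψ} → IsLinear ψ →
    (∀ {u v} → P u → P v → P (u +ᴹ v)) → (∀ c {v} → P v → P (c *ₗ v)) →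
    ∃[ c ] ∃[ e ] c ≤ 1 × c ℕ.+ e ≡ d × BasisOf (λ v → P v × ψ v ≡ 0ℙ) e
  kernelBasis {d = d} B {ψ} Ψ +-closed *-closed with any? (λ i → ψ (BasisOf.b B i) ℙ.≟ 1ℙ)
  kernelBasis {d = suc d} B Ψ +-closed *-closed | yes (i , ψbᵢ≡1) =
    1 , d , s≤s z≤n , refl , Elimination.kernelBasis B Ψ i ψbᵢ≡1 +-closed *-closed
  kernelBasis {d = d} B Ψ +-closed *-closed | no ∄ = 0 , d , z≤n , refl , record
    { b = b ; b∈ = λ i → b∈ i , ≢1⇒≡0 (λ ψbᵢ≡1 → ∄ (i , ψbᵢ≡1))
    ; spanning = λ v (Pv , _) → spanning v Pv ; independent = independent }
    where open BasisOf B

  kernelBases : ∀ {d} → BasisOf U d → ∀ L →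
                ∃[ c ] ∃[ e ] c ≤ length L × c ℕ.+ e ≡ d × BasisOf (Kernel L) e
  kernelBases {d} B [] = 0 , d , z≤n , refl , record
    { b = b ; b∈ = λ _ → [] ; spanning = λ v _ → spanning v _ ; independent = independent }
    where open BasisOf B
  kernelBases {d} B ((ψ , Ψ) ∷ L) =
    let (c , e , c≤ , c+e≡d , B₁) = kernelBases B L
        (c′ , e′ , c′≤1 , c′+e′≡e , B₂) = kernelBasis B₁ Ψ
          (Subspace.+-closed (kernel L)) (Subspace.*-closed (kernel L))
        open BasisOf B₂
    in c′ ℕ.+ c , e′ , ℕ.+-mono-≤ c′≤1 c≤ ,
       (begin
         c′ ℕ.+ c ℕ.+ e′   ≡⟨ cong (ℕ._+ e′) (ℕ.+-comm c′ c) ⟩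
         c ℕ.+ c′ ℕ.+ e′   ≡⟨ ℕ.+-assoc c c′ e′ ⟩
         c ℕ.+ (c′ ℕ.+ e′) ≡⟨ cong (c ℕ.+_) c′+e′≡e ⟩
         c ℕ.+ e           ≡⟨ c+e≡d ⟩
         d                 ∎) ,
       record { b = b ; b∈ = λ i → proj₂ (b∈ i) ∷ proj₁ (b∈ i)
              ; spanning = λ { v (ψv≡0 ∷ v∈) → spanning v (v∈ , ψv≡0) }
              ; independent = independent }
    where open ≡-Reasoning

  space-basis : ∀ (W : Subspace V) {d} → BasisOf (Subspace.Member W) d → HasDimension (Subspace.space W) d
  space-basis W {d} B = (λ i → b i , b∈ i) , record
    { spanning    = λ (v , v∈) → let (c , v≈) = spanning v v∈ in
        c , ≈ᴹ-trans v≈ (≈ᴹ-reflexive (sym (inclusion-sum (λ i → c i *ₛ (b i , b∈ i)))))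
    ; independent = λ c eq → independent c
        (≈ᴹ-trans (≈ᴹ-reflexive (sym (inclusion-sum (λ i → c i *ₛ (b i , b∈ i))))) eq)
    }
    where
    open BasisOf B
    open Subspace W using (space; inclusion)
    open LeftModule space using () renaming (_*ₗ_ to _*ₛ_)
    inclusion-sum : ∀ {d} (f : Vector ∣ space ∣ d) →
                    inclusion (Forms.ΣV.sum space f) ≡ ΣV.sum (inclusion ∘ f)
    inclusion-sum {zero}  f = refl
    inclusion-sum {suc d} f = cong (inclusion (f zero) +ᴹ_) (inclusion-sum (f ∘ suc))

  -- Only an implication from the equations to `Q` is recorded, so `Q` may be a nonlinear condition
  -- and cuts combine by concatenating their lists.
  Cut : ℕ → Pred Carrierᴹ 0ℓ → Set
  Cut q Q = ∃[ L ] length L ≤ q × (∀ v → Kernel L v → Q v)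

  cut-form : (ℓ : LinearForm) → Cut 1 (λ v → proj₁ ℓ v ≡ 0ℙ)
  cut-form ℓ = ℓ ∷ [] , s≤s z≤n , λ { v (ℓv≡0 ∷ []) → ℓv≡0 }

  cut-map : ∀ {q Q R} → (∀ {v} → Q v → R v) → Cut q Q → Cut q R
  cut-map Q⇒R (L , ≤q , Q) = L , ≤q , λ v → Q⇒R ∘ Q v

  cut-× : ∀ {q r Q R} → Cut q Q → Cut r R → Cut (q ℕ.+ r) (λ v → Q v × R v)
  cut-× {q} {r} (L , L≤q , Q) (M , M≤r , R) = L ++ M ,
    subst (_≤ q ℕ.+ r) (sym (List.length-++ L)) (ℕ.+-mono-≤ L≤q M≤r) ,
    λ v v∈ → Q v (All.++⁻ˡ L v∈) , R v (All.++⁻ʳ L v∈)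

  cut-∀ : ∀ {N q} {Q : Fin N → Pred Carrierᴹ 0ℓ} → (∀ i → Cut q (Q i)) →
          Cut (N * q) (λ v → ∀ i → Q i v)
  cut-∀ {zero}  C = [] , z≤n , λ _ _ ()
  cut-∀ {suc N} C = cut-map (λ { (Q₀ , Qₛ) zero → Q₀ ; (Q₀ , Qₛ) (suc i) → Qₛ i })
    (cut-× (C zero) (cut-∀ (C ∘ suc)))

  cut-All : ∀ {A : Set} {q} {Q : A → Pred Carrierᴹ 0ℓ} → (∀ a → Cut q (Q a)) →
            ∀ as → Cut (length as * q) (λ v → All (λ a → Q a v) as)
  cut-All C []       = [] , z≤n , λ _ _ → []
  cut-All C (a ∷ as) = cut-map (λ (Q₀ , Qₛ) → Q₀ ∷ Qₛ) (cut-× (C a) (cut-All C as))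

  cut-≤ : ∀ {q r Q} → q ≤ r → Cut q Q → Cut r Q
  cut-≤ q≤r (L , ≤q , Q) = L , ℕ.≤-trans ≤q q≤r , Q

-- The standard basis and the codimension of a kernel

δ : ∀ {n} → Fin n → Fin n → F₂
δ zero    zero    = 1ℙ
δ zero    (suc j) = 0ℙ
δ (suc i) zero    = 0ℙ
δ (suc i) (suc j) = δ i j

sum-δ : ∀ {n} (c : Vector F₂ n) j → sum (λ i → c i · δ i j) ≡ c j
sum-δ c zero    = trans (cong₂ _+_ (ℙ.*-identityʳ (c zero)) (sum-zero (λ i → ℙ.*-zeroʳ (c (suc i)))))
                        (ℙ.+-identityʳ (c zero))
sum-δ c (suc j) = trans (cong (_+ sum (λ i → c (suc i) · δ i j)) (ℙ.*-zeroʳ (c zero))) (sum-δ (c ∘ suc) j)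

sum-pointwise : ∀ {n d} (f : Vector (Vector F₂ n) d) j →
                Forms.ΣV.sum (F₂^ n) f j ≡ sum (λ i → f i j)
sum-pointwise {d = zero}  f j = refl
sum-pointwise {d = suc d} f j = cong (f zero j +_) (sum-pointwise (f ∘ suc) j)

standardBasis : ∀ n → IsBasis (F₂^ n) δ
standardBasis n = record
  { spanning    = λ v → v , λ j → sym (combination v j)
  ; independent = λ c eq j → trans (sym (combination c j)) (eq j)
  }
  where
  combination : ∀ c j → Forms.ΣV.sum (F₂^ n) (λ i → LeftModule._*ₗ_ (F₂^ n) (c i) (δ i)) j ≡ c j
  combination c j = trans (sum-pointwise (λ i → LeftModule._*ₗ_ (F₂^ n) (c i) (δ i)) j) (sum-δ c j)

kernel-codimension : ∀ n (L : List (Kernels.LinearForm (F₂^ n))) → let U = Kernels.kernel (F₂^ n) L in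
  ∃[ c ] ∃[ d ] c ≤ length L × HasDimension (Subspace.space U) d × HasDimension (F₂^ n) (c ℕ.+ d)
kernel-codimension n L =
  let (c , d , c≤ , c+d≡n , B) = kernelBases whole L
  in c , d , c≤ , space-basis (kernel L) B , subst (HasDimension (F₂^ n)) (sym c+d≡n) (δ , standardBasis n)
  where
  open Kernels (F₂^ n)
  open IsBasis (standardBasis n)
  whole : BasisOf U n
  whole = record { b = δ ; b∈ = λ _ → _ ; spanning = λ v _ → spanning v ; independent = independent }

-- Degeneracy

-- The row f·g of a matrix of rank at most N is determined by at most N columns:
-- a column y₀ with g₀(y₀) = 1 eliminates f₀ from all rows vanishing at y₀.
module Columns {Y : Set} (_~_ : Y → Y → Set)
  (find : ∀ (g : Y → F₂) → (∀ {y y′} → y ~ y′ → g y ≡ g y′) → (∃[ y ] g y ≡ 1ℙ) ⊎ (∀ y → g y ≡ 0ℙ))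
  where

  columns : ∀ N (g : Fin N → Y → F₂) → (∀ i {y y′} → y ~ y′ → g i y ≡ g i y′) →
    ∃[ ys ] length ys ≤ N × (∀ (f : Vector F₂ N) →
      All (λ y → sum (λ i → f i · g i y) ≡ 0ℙ) ys → ∀ y → sum (λ i → f i · g i y) ≡ 0ℙ)
  columns zero    g g-cong = [] , z≤n , λ _ _ _ → refl
  columns (suc N) g g-cong with find (g zero) (g-cong zero)
  ... | inj₂ g₀≡0 =
    let (ys , ys≤N , determines) = columns N (g ∘ suc) (g-cong ∘ suc)
    in ys , ℕ.m≤n⇒m≤1+n ys≤N , λ f F≡0 y → trans (drop f y)
         (determines (f ∘ suc) (All.map (λ {y} → trans (sym (drop f y))) F≡0) y)
    where
    drop : ∀ (f : Vector F₂ (suc N)) y → sum (λ i → f i · g i y) ≡ sum (λ i → f (suc i) · g (suc i) y)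
    drop f y = cong (_+ sum (λ i → f (suc i) · g (suc i) y))
      (trans (cong (f zero ·_) (g₀≡0 y)) (ℙ.*-zeroʳ (f zero)))
  ... | inj₁ (y₀ , g₀y₀≡1) =
    let (ys , ys≤N , determines) = columns N g′
          (λ i y~y′ → cong₂ (λ s t → s + t · g (suc i) y₀) (g-cong (suc i) y~y′) (g-cong zero y~y′))
    in y₀ ∷ ys , s≤s ys≤N , λ { f (Fy₀≡0 ∷ F≡0) y → trans (eliminate f Fy₀≡0 y)
         (determines (f ∘ suc) (All.map (λ {y} → trans (sym (eliminate f Fy₀≡0 y))) F≡0) y) }
    where
    open ≡-Reasoning
    -- Since `g zero y₀` is 1, vanishing at `y₀` expresses `f zero` through the other coefficients.
    -- These are the columns after that substitution.
    g′ : Fin N → Y → F₂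
    g′ i y = g (suc i) y + g zero y · g (suc i) y₀

    eliminate : ∀ (f : Vector F₂ (suc N)) → sum (λ i → f i · g i y₀) ≡ 0ℙ → ∀ y →
                sum (λ i → f i · g i y) ≡ sum (λ i → f (suc i) · g′ i y)
    eliminate f Fy₀≡0 y = begin
      f zero · g zero y + rest y
        ≡⟨ ℙ.+-comm (f zero · g zero y) (rest y) ⟩
      rest y + f zero · g zero y
        ≡⟨ cong (λ s → rest y + s · g zero y) f₀≡rest ⟩
      rest y + rest y₀ · g zero y
        ≡⟨ cong (rest y +_) (*-distribʳ-sum (g zero y) (λ i → f (suc i) · g (suc i) y₀)) ⟩
      rest y + sum (λ i → f (suc i) · g (suc i) y₀ · g zero y)
        ≡⟨ ∑-distrib-+ (λ i → f (suc i) · g (suc i) y) _ ⟨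
      sum (λ i → f (suc i) · g (suc i) y + f (suc i) · g (suc i) y₀ · g zero y)
        ≡⟨ sum-cong-≗ (λ i → trans
             (cong (f (suc i) · g (suc i) y +_) (trans (ℙ.*-assoc (f (suc i)) _ _)
               (cong (f (suc i) ·_) (ℙ.*-comm (g (suc i) y₀) (g zero y)))))
             (sym (ℙ.*-distribˡ-+ (f (suc i)) _ _))) ⟩
      sum (λ i → f (suc i) · g′ i y) ∎
      where
      rest : Y → F₂
      rest y = sum (λ i → f (suc i) · g (suc i) y)
      f₀≡rest : f zero ≡ rest y₀
      f₀≡rest = p+q≡0⇒p≡q (trans
        (cong (_+ rest y₀) (sym (trans (cong (f zero ·_) g₀y₀≡1) (ℙ.*-identityʳ (f zero))))) Fy₀≡0)

-- Exhaustive search over vectors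

search : ∀ {n} {P : Pred (Vector F₂ n) 0ℓ} → (∀ {u v} → (∀ i → u i ≡ v i) → P u → P v) →
         Decidable P → Dec (∃ P)
search {zero}  P-resp P? with P? (λ ())
... | yes p = yes (_ , p)
... | no ¬p = no (λ (_ , p) → ¬p (P-resp (λ ()) p))
search {suc n} P-resp P? with search (P-resp ∘ ∷-cong 0ℙ) (P? ∘ (0ℙ Vector.∷_))
                            | search (P-resp ∘ ∷-cong 1ℙ) (P? ∘ (1ℙ Vector.∷_))
  where
  ∷-cong : ∀ p {u v : Vector F₂ n} → (∀ i → u i ≡ v i) → ∀ i → (p Vector.∷ u) i ≡ (p Vector.∷ v) i
  ∷-cong p u≗v zero    = refl
  ∷-cong p u≗v (suc i) = u≗v i
... | yes (_ , p) | _           = yes (_ , p)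
... | no  _       | yes (_ , p) = yes (_ , p)
... | no ¬p₀      | no ¬p₁      = no none
  where
  none : _
  none (v , p) with v zero in eq
  -- Head and tail reassemble to `v` only pointwise, whence `P-resp`.
  ... | 0ℙ = ¬p₀ (Vector.tail v , P-resp (λ { zero → eq ; (suc i) → refl }) p)
  ... | 1ℙ = ¬p₁ (Vector.tail v , P-resp (λ { zero → eq ; (suc i) → refl }) p)

module _ {n} {Q : Pred (Vector F₂ n) 0ℓ} (Q-resp : ∀ {u v} → (∀ i → u i ≡ v i) → Q u → Q v)
         (Q? : Decidable Q) where

  private
    _≗₁_ : ∃ Q → ∃ Q → Set
    u ≗₁ v = ∀ i → proj₁ u i ≡ proj₁ v i

  searchIn : ∀ {R : Pred (∃ Q) 0ℓ} → (∀ {u v} → u ≗₁ v → R u → R v) → Decidable R → Dec (∃ R)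
  searchIn {R} R-resp R? with search {P = λ v → Σ (Q v) λ q → R (v , q)}
    (λ u≗v (q , r) → Q-resp u≗v q , R-resp u≗v r) decide
    where
    decide : Decidable (λ v → Σ (Q v) λ q → R (v , q))
    decide v with Q? v
    ... | no ¬q = no (¬q ∘ proj₁)
    ... | yes q with R? (v , q)
    ...   | yes r = yes (q , r)
    ...   | no ¬r = no (λ (_ , r) → ¬r (R-resp (λ _ → refl) r))
  ... | yes (v , q , r) = yes ((v , q) , r)
  ... | no ¬r           = no (λ ((v , q) , r) → ¬r (v , q , r))

  _≗₂_ : ∃ Q × ∃ Q → ∃ Q × ∃ Q → Set
  (u , v) ≗₂ (u′ , v′) = u ≗₁ u′ × v ≗₁ v′

  find : ∀ (g : ∃ Q × ∃ Q → F₂) → (∀ {y y′} → y ≗₂ y′ → g y ≡ g y′) →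
         (∃[ y ] g y ≡ 1ℙ) ⊎ (∀ y → g y ≡ 0ℙ)
  find g g-cong with searchIn
    (λ {u} {u′} u≗u′ (v , eq) → v , trans (g-cong ((λ i → sym (u≗u′ i)) , λ _ → refl)) eq)
    (λ u → searchIn (λ v≗v′ eq → trans (g-cong ((λ _ → refl) , λ i → sym (v≗v′ i))) eq)
                    (λ v → g (u , v) ℙ.≟ 1ℙ))
  ... | yes (u , v , eq) = inj₁ ((u , v) , eq)
  ... | no ∄             = inj₂ (λ (u , v) → ≢1⇒≡0 (λ eq → ∄ (u , v , eq)))

-- Products of forms in three and four variables

module Terms (V : VectorSpace) where
  open LeftModule V
  open Forms V
  open Kernels V

  0-linear : IsLinear (const 0ℙ)
  0-linear = record { ≈-cong = λ _ → refl ; +-homo = λ _ _ → refl }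

  -- Since `f` reads only variable `i`, constant tuples suffice. Additivity allows only one slot to
  -- differ, so `update` keeps `u +ᴹ v` in all others until `local` discards them.
  linearIn : ∀ {k} {i : Fin k} {f : Form k} → MultilinearIn (_∈ ⁅ i ⁆) f → IsLinear (λ u → f (const u))
  linearIn {i = i} F = record
    { ≈-cong = λ u≈v → local (λ _ _ → u≈v)
    ; +-homo = λ u v → trans (additive (x∈⁅x⁆ i) {y = update u (u +ᴹ v)} {z = update v (u +ᴹ v)}
        off-i off-i (≈ᴹ-sym (+ᴹ-cong (at-i (x∈⁅x⁆ i)) (at-i (x∈⁅x⁆ i)))))
        (cong₂ _+_ (local (λ _ → at-i)) (local (λ _ → at-i)))
    }
    where
    open MultilinearIn F
    update : Carrierᴹ → Carrierᴹ → Fin _ → Carrierᴹ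
    update u w j with j ≟ i
    ... | yes _ = u
    ... | no  _ = w
    at-i : ∀ {u w j} → j ∈ ⁅ i ⁆ → update u w j ≈ᴹ u
    at-i {j = j} j∈ with j ≟ i
    ... | yes _   = ≈ᴹ-refl
    ... | no  j≢i = ⊥-elim (j≢i (x∈⁅y⁆⇒x≡y i j∈))
    off-i : ∀ {u w} j → j ≢ i → update u w j ≈ᴹ w
    off-i j j≢i with j ≟ i
    ... | yes j≡i = ⊥-elim (j≢i j≡i)
    ... | no  _   = ≈ᴹ-refl

  IsBilinear : (Carrierᴹ → Carrierᴹ → F₂) → Set
  IsBilinear f = (∀ v → IsLinear (λ u → f u v)) × (∀ u → IsLinear (f u))

  0-bilinear : IsBilinear (λ _ _ → 0ℙ)
  0-bilinear = (λ _ → 0-linear) , (λ _ → 0-linear)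

  module _ {k} {i j : Fin k} (i≢j : i ≢ j) {f : Form k} (F : MultilinearIn (_∈ ⁅ i ⁆ ∪ ⁅ j ⁆) f) where
    open MultilinearIn F

    private
      _∣_ : Carrierᴹ → Carrierᴹ → Fin k → Carrierᴹ
      (u ∣ v) l with l ≟ i
      ... | yes _ = u
      ... | no  _ = v

      ∣-cong : ∀ {u v u′ v′} → u ≈ᴹ u′ → v ≈ᴹ v′ → ∀ l → (u ∣ v) l ≈ᴹ (u′ ∣ v′) l
      ∣-cong u≈u′ v≈v′ l with l ≟ i
      ... | yes _ = u≈u′
      ... | no  _ = v≈v′

      ∣-first : ∀ {u v} → (u ∣ v) i ≡ u
      ∣-first with i ≟ i
      ... | yes _   = refl
      ... | no  i≢i = ⊥-elim (i≢i refl)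

      ∣-other : ∀ {u v l} → l ≢ i → (u ∣ v) l ≡ v
      ∣-other {l = l} l≢i with l ≟ i
      ... | yes l≡i = ⊥-elim (l≢i l≡i)
      ... | no  _   = refl

    -- The second vector fills every slot but `i`; among those only `j` is read.
    reduce : Carrierᴹ → Carrierᴹ → F₂
    reduce u v = f (u ∣ v)

    ≡-reduce : ∀ x → f x ≡ reduce (x i) (x j)
    ≡-reduce x = local λ l l∈ → ≈ᴹ-sym (≈ᴹ-reflexive (at l (x∈p∪q⁻ ⁅ i ⁆ ⁅ j ⁆ l∈)))
      where
      at : ∀ l → l ∈ ⁅ i ⁆ ⊎ l ∈ ⁅ j ⁆ → (x i ∣ x j) l ≡ x l
      at l (inj₁ l∈) rewrite x∈⁅y⁆⇒x≡y i l∈ = ∣-first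
      at l (inj₂ l∈) rewrite x∈⁅y⁆⇒x≡y j l∈ = ∣-other (i≢j ∘ sym)

    reduce-bilinear : IsBilinear reduce
    reduce-bilinear =
      (λ v → record
        { ≈-cong = λ u≈u′ → local (λ l _ → ∣-cong u≈u′ ≈ᴹ-refl l)
        ; +-homo = λ u u′ → additive {i} (x∈p∪q⁺ (inj₁ (x∈⁅x⁆ i)))
            (λ l l≢i → ≈ᴹ-reflexive (trans (∣-other l≢i) (sym (∣-other l≢i))))
            (λ l l≢i → ≈ᴹ-reflexive (trans (∣-other l≢i) (sym (∣-other l≢i))))
            (≈ᴹ-reflexive (trans (∣-first {v = v}) (sym (cong₂ _+ᴹ_ (∣-first {v = v}) (∣-first {v = v}))))) }) ,
      (λ u → record
        { ≈-cong = λ v≈v′ → local (λ l _ → ∣-cong ≈ᴹ-refl v≈v′ l)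
        ; +-homo = λ v v′ → trans
            -- As the second vector occupies many slots, `at-j` changes slot `j` alone, and `local`
            -- then adjusts the slots that `f` ignores.
            (additive {j} (x∈p∪q⁺ (inj₂ (x∈⁅x⁆ j))) {y = at-j u (v +ᴹ v′) v} {z = at-j u (v +ᴹ v′) v′}
              off-j off-j
              (≈ᴹ-trans (≈ᴹ-reflexive (∣-other (i≢j ∘ sym))) (≈ᴹ-sym (+ᴹ-cong (on-j {u}) (on-j {u})))))
            (cong₂ _+_ (local (collect u)) (local (collect u))) })
      where
      at-j : Carrierᴹ → Carrierᴹ → Carrierᴹ → Fin k → Carrierᴹ
      at-j u w v l with l ≟ j
      ... | yes _ = v
      ... | no  _ = (u ∣ w) l
      off-j : ∀ {u w v} l → l ≢ j → at-j u w v l ≈ᴹ (u ∣ w) l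
      off-j l l≢j with l ≟ j
      ... | yes l≡j = ⊥-elim (l≢j l≡j)
      ... | no  _   = ≈ᴹ-refl
      on-j : ∀ {u w v} → at-j u w v j ≈ᴹ v
      on-j with j ≟ j
      ... | yes _   = ≈ᴹ-refl
      ... | no  j≢j = ⊥-elim (j≢j refl)
      collect : ∀ u {w v} l → l ∈ ⁅ i ⁆ ∪ ⁅ j ⁆ → at-j u w v l ≈ᴹ (u ∣ v) l
      collect u {w} {v} l l∈ with l ≟ j | x∈p∪q⁻ ⁅ i ⁆ ⁅ j ⁆ l∈
      ... | yes refl | _        = ≈ᴹ-sym (≈ᴹ-reflexive (∣-other (i≢j ∘ sym)))
      ... | no  _    | inj₁ l∈ᵢ rewrite x∈⁅y⁆⇒x≡y i l∈ᵢ =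
        ≈ᴹ-reflexive (trans (∣-first {v = w}) (sym (∣-first {v = v})))
      ... | no  l≢j  | inj₂ l∈ⱼ = ⊥-elim (l≢j (x∈⁅y⁆⇒x≡y j l∈ⱼ))

  Killable : ∀ {k} → Form k → Set
  Killable {k} T = Σ LinearForm λ ℓ → Σ (Fin k) λ i → ∀ (x : Fin k → Carrierᴹ) → proj₁ ℓ (x i) ≡ 0ℙ → T x ≡ 0ℙ

  killable : ∀ {k} (i : Fin k) {T : Form k} (β γ : Form k) → MultilinearIn (_∈ ⁅ i ⁆) β →
             (∀ x → T x ≡ β x · γ x) → Killable T
  killable i β γ B T≡ = (_ , linearIn B) , i , λ x ℓxᵢ≡0 → trans (T≡ x) (cong (_· γ x)
    (trans (MultilinearIn.local B (λ j j∈ → ≈ᴹ-reflexive (cong x (x∈⁅y⁆⇒x≡y i j∈)))) ℓxᵢ≡0))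

  module _ {k} {T : Form k} (S : Splitting T) where
    open Splitting S

    splits-flipped : ∀ x → T x ≡ γ x · β x
    splits-flipped x = trans (splits x) (ℙ.*-comm (β x) (γ x))

    killable-β : ∀ i → I ≡ ⁅ i ⁆ → Killable T
    killable-β i refl = killable i β γ β-in splits

    killable-γ : ∀ i → ∁ I ≡ ⁅ i ⁆ → Killable T
    killable-γ i ∁I≡ = killable i γ β (subst (λ J → MultilinearIn (_∈ J) γ) ∁I≡ γ-in) splits-flipped

  -- In a partition of three variables into two nonempty sides, one side is a singleton.
  killable₃ : ∀ {T : Form 3} → Splitting T → Killable T
  killable₃ record { I = outside ∷ outside ∷ outside ∷ [] ; I-nonempty = _ , i∈ } = ⊥-elim (∉⊥ i∈)
  killable₃ record { I = inside  ∷ inside  ∷ inside  ∷ [] ; ∁I-nonempty = _ , i∈ } = ⊥-elim (∉⊥ i∈)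
  killable₃ S@record { I = inside  ∷ outside ∷ outside ∷ [] } = killable-β S 0F refl
  killable₃ S@record { I = outside ∷ inside  ∷ outside ∷ [] } = killable-β S 1F refl
  killable₃ S@record { I = outside ∷ outside ∷ inside  ∷ [] } = killable-β S 2F refl
  killable₃ S@record { I = outside ∷ inside  ∷ inside  ∷ [] } = killable-γ S 0F refl
  killable₃ S@record { I = inside  ∷ outside ∷ inside  ∷ [] } = killable-γ S 1F refl
  killable₃ S@record { I = inside  ∷ inside  ∷ outside ∷ [] } = killable-γ S 2F refl

  quad : Carrierᴹ → Carrierᴹ → Carrierᴹ → Carrierᴹ → Fin 4 → Carrierᴹ
  quad e a b c = e Vector.∷ a Vector.∷ b Vector.∷ c Vector.∷ Vector.[]

  -- On the kernel of ℓ, T(e,a,b,c) is one of 0, f(e,a) g(b,c), f(e,b) g(a,c)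
  -- and s(a,b) s′(e,c); only the following two consequences matter.
  record Shape (T : Form 4) : Set where
    field
      ℓ           : LinearForm
      f g s s′    : Carrierᴹ → Carrierᴹ → F₂
      g-bilinear  : IsBilinear g
      s-bilinear  : IsBilinear s
      s′-bilinear : IsBilinear s′
      swapped     : ∀ {e a b c} → (∀ i → proj₁ ℓ (quad e a b c i) ≡ 0ℙ) →
        T (quad e a b c) + T (quad e b a c) ≡ (f e a · g b c + f e b · g a c) + (s a b + s b a) · s′ e c
      diagonal₂   : ∀ {e d c} → (∀ i → proj₁ ℓ (quad e d d c i) ≡ 0ℙ) →
        T (quad e d d c) ≡ f e d · g d c + s d d · s′ e c

  shape-0 : ∀ {T} → Killable T → Shape T
  shape-0 {T} (ℓ , i , vanish) = record
    { ℓ = ℓ ; f = λ _ _ → 0ℙ ; g = λ _ _ → 0ℙ ; s = λ _ _ → 0ℙ ; s′ = λ _ _ → 0ℙ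
    ; g-bilinear = 0-bilinear ; s-bilinear = 0-bilinear ; s′-bilinear = 0-bilinear
    ; swapped   = λ ∈ℓ → cong₂ _+_ (vanish _ (∈ℓ i)) (vanish _ (exchange ∈ℓ i))
    ; diagonal₂ = λ ∈ℓ → vanish _ (∈ℓ i)
    }
    where
    exchange : ∀ {e a b c} → (∀ i → proj₁ ℓ (quad e a b c i) ≡ 0ℙ) → ∀ i → proj₁ ℓ (quad e b a c i) ≡ 0ℙ
    exchange ∈ℓ 0F = ∈ℓ 0F
    exchange ∈ℓ 1F = ∈ℓ 2F
    exchange ∈ℓ 2F = ∈ℓ 1F
    exchange ∈ℓ 3F = ∈ℓ 3F

  module _ {T β γ : Form 4} (T≡ : ∀ x → T x ≡ β x · γ x) where

    private
      reduced : ∀ {i j i′ j′ : Fin 4} (i≢j : i ≢ j) (i′≢j′ : i′ ≢ j′)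
                (B : MultilinearIn (_∈ ⁅ i ⁆ ∪ ⁅ j ⁆) β) (C : MultilinearIn (_∈ ⁅ i′ ⁆ ∪ ⁅ j′ ⁆) γ) → ∀ x →
                T x ≡ reduce i≢j B (x i) (x j) · reduce i′≢j′ C (x i′) (x j′)
      reduced i≢j i′≢j′ B C x = trans (T≡ x) (cong₂ _·_ (≡-reduce i≢j B x) (≡-reduce i′≢j′ C x))

      0≢1 : _≢_ {A = Fin 4} 0F 1F
      0≢1 ()
      0≢2 : _≢_ {A = Fin 4} 0F 2F
      0≢2 ()
      0≢3 : _≢_ {A = Fin 4} 0F 3F
      0≢3 ()
      1≢2 : _≢_ {A = Fin 4} 1F 2F
      1≢2 ()
      1≢3 : _≢_ {A = Fin 4} 1F 3F
      1≢3 ()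
      2≢3 : _≢_ {A = Fin 4} 2F 3F
      2≢3 ()

    shape-01∣23 : MultilinearIn (_∈ ⁅ 0F ⁆ ∪ ⁅ 1F ⁆) β → MultilinearIn (_∈ ⁅ 2F ⁆ ∪ ⁅ 3F ⁆) γ → Shape T
    shape-01∣23 B C = record
      { ℓ = _ , 0-linear ; f = f ; g = g ; s = λ _ _ → 0ℙ ; s′ = λ _ _ → 0ℙ
      ; g-bilinear = reduce-bilinear 2≢3 C ; s-bilinear = 0-bilinear ; s′-bilinear = 0-bilinear
      ; swapped   = λ {e} {a} {b} {c} _ → trans (cong₂ _+_ (T≡fg (quad e a b c)) (T≡fg (quad e b a c)))
          (sym (ℙ.+-identityʳ (f e a · g b c + f e b · g a c)))
      ; diagonal₂ = λ {e} {d} {c} _ → trans (T≡fg (quad e d d c)) (sym (ℙ.+-identityʳ (f e d · g d c)))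
      }
      where
      f = reduce 0≢1 B
      g = reduce 2≢3 C
      T≡fg = reduced 0≢1 2≢3 B C

    -- This is the previous type with `a` and `b` interchanged. As `swapped` adds both orders and
    -- `diagonal₂` has both arguments equal, the same shape fits.
    shape-02∣13 : MultilinearIn (_∈ ⁅ 0F ⁆ ∪ ⁅ 2F ⁆) β → MultilinearIn (_∈ ⁅ 1F ⁆ ∪ ⁅ 3F ⁆) γ → Shape T
    shape-02∣13 B C = record
      { ℓ = _ , 0-linear ; f = f ; g = g ; s = λ _ _ → 0ℙ ; s′ = λ _ _ → 0ℙ
      ; g-bilinear = reduce-bilinear 1≢3 C ; s-bilinear = 0-bilinear ; s′-bilinear = 0-bilinear
      ; swapped   = λ {e} {a} {b} {c} _ → trans (cong₂ _+_ (T≡fg (quad e a b c)) (T≡fg (quad e b a c)))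
          (trans (ℙ.+-comm (f e b · g a c) (f e a · g b c))
                 (sym (ℙ.+-identityʳ (f e a · g b c + f e b · g a c))))
      ; diagonal₂ = λ {e} {d} {c} _ → trans (T≡fg (quad e d d c)) (sym (ℙ.+-identityʳ (f e d · g d c)))
      }
      where
      f = reduce 0≢2 B
      g = reduce 1≢3 C
      T≡fg = reduced 0≢2 1≢3 B C

    shape-12∣03 : MultilinearIn (_∈ ⁅ 1F ⁆ ∪ ⁅ 2F ⁆) β → MultilinearIn (_∈ ⁅ 0F ⁆ ∪ ⁅ 3F ⁆) γ → Shape T
    shape-12∣03 B C = record
      { ℓ = _ , 0-linear ; f = λ _ _ → 0ℙ ; g = λ _ _ → 0ℙ ; s = s ; s′ = s′
      ; g-bilinear = 0-bilinear ; s-bilinear = reduce-bilinear 1≢2 B ; s′-bilinear = reduce-bilinear 0≢3 C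
      ; swapped   = λ {e} {a} {b} {c} _ → trans (cong₂ _+_ (T≡ss′ (quad e a b c)) (T≡ss′ (quad e b a c)))
          (sym (ℙ.*-distribʳ-+ (s′ e c) (s a b) (s b a)))
      ; diagonal₂ = λ {e} {d} {c} _ → T≡ss′ (quad e d d c)
      }
      where
      s = reduce 1≢2 B
      s′ = reduce 0≢3 C
      T≡ss′ = reduced 1≢2 0≢3 B C

  -- Of the sixteen subsets, two are excluded as trivial, eight have a singleton on one side, and
  -- six split the variables two and two, giving three types up to exchanging the factors.
  shape : ∀ {T} → Splitting T → Shape T
  shape record { I = outside ∷ outside ∷ outside ∷ outside ∷ [] ; I-nonempty = _ , i∈ } = ⊥-elim (∉⊥ i∈)
  shape record { I = inside ∷ inside ∷ inside ∷ inside ∷ [] ; ∁I-nonempty = _ , i∈ } = ⊥-elim (∉⊥ i∈)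
  shape S@record { I = inside ∷ outside ∷ outside ∷ outside ∷ [] } = shape-0 (killable-β S 0F refl)
  shape S@record { I = outside ∷ inside ∷ outside ∷ outside ∷ [] } = shape-0 (killable-β S 1F refl)
  shape S@record { I = outside ∷ outside ∷ inside ∷ outside ∷ [] } = shape-0 (killable-β S 2F refl)
  shape S@record { I = outside ∷ outside ∷ outside ∷ inside ∷ [] } = shape-0 (killable-β S 3F refl)
  shape S@record { I = outside ∷ inside ∷ inside ∷ inside ∷ [] } = shape-0 (killable-γ S 0F refl)
  shape S@record { I = inside ∷ outside ∷ inside ∷ inside ∷ [] } = shape-0 (killable-γ S 1F refl)
  shape S@record { I = inside ∷ inside ∷ outside ∷ inside ∷ [] } = shape-0 (killable-γ S 2F refl)
  shape S@record { I = inside ∷ inside ∷ inside ∷ outside ∷ [] } = shape-0 (killable-γ S 3F refl)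
  shape S@record { I = inside ∷ inside ∷ outside ∷ outside ∷ [] ; β-in = B ; γ-in = C } =
    shape-01∣23 (Splitting.splits S) B C
  shape S@record { I = outside ∷ outside ∷ inside ∷ inside ∷ [] ; β-in = B ; γ-in = C } =
    shape-01∣23 (splits-flipped S) C B
  shape S@record { I = inside ∷ outside ∷ inside ∷ outside ∷ [] ; β-in = B ; γ-in = C } =
    shape-02∣13 (Splitting.splits S) B C
  shape S@record { I = outside ∷ inside ∷ outside ∷ inside ∷ [] ; β-in = B ; γ-in = C } =
    shape-02∣13 (splits-flipped S) C B
  shape S@record { I = outside ∷ inside ∷ inside ∷ outside ∷ [] ; β-in = B ; γ-in = C } =
    shape-12∣03 (Splitting.splits S) B C
  shape S@record { I = inside ∷ outside ∷ outside ∷ inside ∷ [] ; β-in = B ; γ-in = C } =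
    shape-12∣03 (splits-flipped S) C B

-- Linear equations that make `α` vanish on tuples with two repeated pairs

module Degeneracy (n : ℕ) where
  V : VectorSpace
  V = F₂^ n
  open LeftModule V
  open Forms V
  open Kernels V
  open Terms V
  open Update V

  module _ {N : ℕ} {T : Fin N → Form 4} (S : ∀ i → Splitting (T i)) {φ : Form 4}
    (φ≡ΣT : ∀ x → φ x ≡ sum (λ i → T i x))
    (φ-swap : ∀ e a b c → φ (quad e a b c) ≡ φ (quad e b a c))
    (φ-linear : ∀ e c → IsLinear (λ d → φ (quad e d d c))) where

    private
      module T i = Shape (shape (S i))
      open IsLinear

      W : Pred Carrierᴹ 0ℓ
      W v = ∀ i → proj₁ (T.ℓ i) v ≡ 0ℙ

      W-resp : ∀ {u v} → u ≈ᴹ v → W u → W v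
      W-resp u≈v u∈W i = trans (sym (≈-cong (proj₂ (T.ℓ i)) u≈v)) (u∈W i)

      W? : Decidable W
      W? v = all? (λ i → proj₁ (T.ℓ i) v ℙ.≟ 0ℙ)

      W-quad : ∀ {e a b c} → W e → W a → W b → W c → ∀ i l → proj₁ (T.ℓ i) (quad e a b c l) ≡ 0ℙ
      W-quad e∈ a∈ b∈ c∈ i 0F = e∈ i
      W-quad e∈ a∈ b∈ c∈ i 1F = a∈ i
      W-quad e∈ a∈ b∈ c∈ i 2F = b∈ i
      W-quad e∈ a∈ b∈ c∈ i 3F = c∈ i

      open Columns {Y = ∃ W × ∃ W} (_≗₂_ W-resp W?) (find W-resp W?)

      bilinear-cong : ∀ {f u v u′ v′} → IsBilinear f → u ≈ᴹ u′ → v ≈ᴹ v′ → f u v ≡ f u′ v′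
      bilinear-cong (F₁ , F₂) u≈u′ v≈v′ = trans (≈-cong (F₁ _) u≈u′) (≈-cong (F₂ _) v≈v′)

      -- At most `N` test pairs (b, c): a combination of the `T.g i` vanishing there vanishes on all
      -- pairs from `W`, whatever its coefficients. `columns₂` does the same for `T.s′` and pairs
      -- (e, c).
      columns₁ = columns N (λ i ((b , _) , (c , _)) → T.g i b c)
        (λ i (b≗ , c≗) → bilinear-cong (T.g-bilinear i) b≗ c≗)

      columns₂ = columns N (λ i ((e , _) , (c , _)) → T.s′ i e c)
        (λ i (e≗ , c≗) → bilinear-cong (T.s′-bilinear i) e≗ c≗)

      Separated : Pred Carrierᴹ 0ℓ
      Separated a = All (λ ((b , _) , (c , _)) → ∀ i →
        T.g i a c ≡ 0ℙ × T.s i a b ≡ 0ℙ × T.s i b a ≡ 0ℙ) (proj₁ columns₁)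

      -- At most `N` test pairs, `N` products for each, and three equations linear in `a` per
      -- product.
      cut-separated : Cut (N * (N * 3)) Separated
      cut-separated = cut-≤ (ℕ.*-monoˡ-≤ (N * 3) (proj₁ (proj₂ columns₁)))
        (cut-All (λ ((b , _) , (c , _)) → cut-∀ λ i →
            cut-× (cut-form (_ , proj₁ (T.g-bilinear i) c))
              (cut-× (cut-form (_ , proj₁ (T.s-bilinear i) b)) (cut-form (_ , proj₂ (T.s-bilinear i) b))))
          (proj₁ columns₁))

      -- By symmetry in the two middle variables
      --   ∑ f(e,a) g(b,c) = ∑ f(e,b) g(a,c) + ∑ (s(a,b) + s(b,a)) s′(e,c),
      -- and for fixed (b,c) every term on the right has a factor linear in a.
      separated-part : ∀ {e a b c} → W e → W a → Separated a → W b → W c →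
                       sum (λ i → T.f i e a · T.g i b c) ≡ 0ℙ
      separated-part {e} {a} e∈ a∈ separated b∈ c∈ = proj₂ (proj₂ columns₁) (λ i → T.f i e a)
        (All.map (λ { {(b , b∈) , (c , c∈)} → vanish b∈ c∈ }) separated) ((_ , b∈) , (_ , c∈))
        where
        open ≡-Reasoning
        vanish : ∀ {b c} → W b → W c → (∀ i → T.g i a c ≡ 0ℙ × T.s i a b ≡ 0ℙ × T.s i b a ≡ 0ℙ) →
                 sum (λ i → T.f i e a · T.g i b c) ≡ 0ℙ
        vanish {b} {c} b∈ c∈ zeros = begin
          sum (λ i → T.f i e a · T.g i b c)
            ≡⟨ sum-cong-≗ term ⟨
          sum (λ i → T i (quad e a b c) + T i (quad e b a c))
            ≡⟨ ∑-distrib-+ (λ i → T i (quad e a b c)) (λ i → T i (quad e b a c)) ⟩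
          sum (λ i → T i (quad e a b c)) + sum (λ i → T i (quad e b a c))
            ≡⟨ cong₂ _+_ (φ≡ΣT (quad e a b c)) (φ≡ΣT (quad e b a c)) ⟨
          φ (quad e a b c) + φ (quad e b a c)
            ≡⟨ cong (φ (quad e a b c) +_) (φ-swap e b a c) ⟩
          φ (quad e a b c) + φ (quad e a b c)
            ≡⟨ ℙ.p+p≡0ℙ (φ (quad e a b c)) ⟩
          0ℙ ∎
          where
          term : ∀ i → T i (quad e a b c) + T i (quad e b a c) ≡ T.f i e a · T.g i b c
          term i = let (gac≡0 , sab≡0 , sba≡0) = zeros i ; fg = T.f i e a · T.g i b c in begin
            T i (quad e a b c) + T i (quad e b a c)
              ≡⟨ T.swapped i (W-quad e∈ a∈ b∈ c∈ i) ⟩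
            (fg + T.f i e b · T.g i a c) + (T.s i a b + T.s i b a) · T.s′ i e c
              ≡⟨ cong₂ (λ p q → (fg + T.f i e b · p) + q · T.s′ i e c) gac≡0 (cong₂ _+_ sab≡0 sba≡0) ⟩
            (fg + T.f i e b · 0ℙ) + 0ℙ
              ≡⟨ ℙ.+-identityʳ (fg + T.f i e b · 0ℙ) ⟩
            fg + T.f i e b · 0ℙ
              ≡⟨ trans (cong (fg +_) (ℙ.*-zeroʳ (T.f i e b))) (ℙ.+-identityʳ fg) ⟩
            fg ∎

      Diagonal : Pred Carrierᴹ 0ℓ
      Diagonal d = All (λ ((e , _) , (c , _)) → φ (quad e d d c) ≡ 0ℙ) (proj₁ columns₂)

      cut-diagonal : Cut (N * 1) Diagonal
      cut-diagonal = cut-≤ (ℕ.*-monoˡ-≤ 1 (proj₁ (proj₂ columns₂)))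
        (cut-All (λ ((e , _) , (c , _)) → cut-form (_ , φ-linear e c)) (proj₁ columns₂))

      -- `separated-part` with both middle arguments equal to `d` leaves only the sum of the
      -- `s(d,d) s′(e,c)`. For fixed `d` this is a combination of the `T.s′ i`, and `Diagonal` makes
      -- it vanish at its test pairs.
      diagonal-vanishes : ∀ {d} → W d → Separated d → Diagonal d → ∀ {e c} → W e → W c →
                          φ (quad e d d c) ≡ 0ℙ
      diagonal-vanishes {d} d∈ separated diagonal e∈ c∈ = trans (together e∈ c∈)
        (proj₂ (proj₂ columns₂) (λ i → T.s i d d)
          (All.map (λ { {(e , e∈) , (c , c∈)} φ≡0 → trans (sym (together e∈ c∈)) φ≡0 }) diagonal)
          ((_ , e∈) , (_ , c∈)))
        where
        open ≡-Reasoning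
        together : ∀ {e c} → W e → W c → φ (quad e d d c) ≡ sum (λ i → T.s i d d · T.s′ i e c)
        together {e} {c} e∈ c∈ = begin
          φ (quad e d d c)
            ≡⟨ φ≡ΣT (quad e d d c) ⟩
          sum (λ i → T i (quad e d d c))
            ≡⟨ sum-cong-≗ (λ i → T.diagonal₂ i (W-quad e∈ d∈ d∈ c∈ i)) ⟩
          sum (λ i → T.f i e d · T.g i d c + T.s i d d · T.s′ i e c)
            ≡⟨ ∑-distrib-+ (λ i → T.f i e d · T.g i d c) (λ i → T.s i d d · T.s′ i e c) ⟩
          sum (λ i → T.f i e d · T.g i d c) + sum (λ i → T.s i d d · T.s′ i e c)
            ≡⟨ cong (_+ sum (λ i → T.s i d d · T.s′ i e c)) (separated-part e∈ d∈ separated d∈ c∈) ⟩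
          sum (λ i → T.s i d d · T.s′ i e c) ∎

    cut₅ : Σ (Pred Carrierᴹ 0ℓ) λ P → Cut (N * 1 ℕ.+ (N * (N * 3) ℕ.+ N * 1)) P ×
           (∀ {e d c} → P e → P d → P c → φ (quad e d d c) ≡ 0ℙ)
    cut₅ = (λ v → W v × Separated v × Diagonal v) ,
      cut-× (cut-∀ (λ i → cut-form (T.ℓ i))) (cut-× cut-separated cut-diagonal) ,
      λ { (e∈ , _) (d∈ , separated , diagonal) (c∈ , _) → diagonal-vanishes d∈ separated diagonal e∈ c∈ }

  -- Positivity of `r` absorbs the linear terms into squares, giving 1 + 3 + 1 = 5.
  bound : ∀ {N r} → N ≤ r → 0 < r → N * 1 ℕ.+ (N * (N * 3) ℕ.+ N * 1) ≤ 5 * (r * r)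
  bound {N} {r} N≤r 0<r = ℕ.≤-trans
    (ℕ.+-mono-≤ N*1≤r*r (ℕ.+-mono-≤ (ℕ.*-mono-≤ N≤r (ℕ.*-monoˡ-≤ 3 N≤r)) N*1≤r*r))
    (ℕ.≤-reflexive (regroup r))
    where
    N*1≤r*r = ℕ.*-mono-≤ N≤r 0<r
    regroup : ∀ r → r * r ℕ.+ (r * (r * 3) ℕ.+ r * r) ≡ 5 * (r * r)
    regroup = solve-∀

  DegenerateOn : ∀ {k} → ℕ → Form (2 ℕ.+ k) → Pred Carrierᴹ 0ℓ → Set
  DegenerateOn {k} m α P = ∀ (p q : Fin k) x → (∀ j → P (x j)) → toℕ p < toℕ q → toℕ q < m →
    x zero ≈ᴹ x (suc zero) → x (suc (suc p)) ≈ᴹ x (suc (suc q)) → α x ≡ 0ℙ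

  degenerate-cut : ∀ {k m r} → 2 ℕ.+ k ≤ 5 → 0 < r → {α : Form (2 ℕ.+ k)} → MultilinearIn U α →
    SymmetricInFirst (2 ℕ.+ m) α → ∀ {N} {T : Fin N → Form (1 ℕ.+ k)} → N ≤ r → (∀ i → Splitting (T i)) →
    (∀ y → α (y ∘ pinch zero) ≡ sum (λ i → T i y)) →
    ∃[ L ] length L ≤ 5 * (r * r) × DegenerateOn m α (Kernel L)
  -- With two or three variables there is no pair `p < q` beyond the first two positions.
  degenerate-cut {0} _ _ _ _ _ _ _ = [] , z≤n , λ ()
  degenerate-cut {1} _ _ _ _ _ _ _ = [] , z≤n , λ { zero zero _ _ () }
  -- With four variables the diagonal has three, so one equation per product kills it.
  degenerate-cut {2} _ 0<r {α} A _ {N} {T} N≤r S φ≡ΣT =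
    let (L , L≤ , ∈W) = cut-≤ (ℕ.≤-trans (ℕ.m≤m+n (N * 1) _) (bound N≤r 0<r))
                          (cut-∀ (λ i → cut-form (proj₁ (killable₃ (S i)))))
    in L , L≤ , λ p q x x∈ _ _ x₀≈x₁ _ → trans
         (MultilinearIn.local A {y = (x ∘ punch) ∘ pinch zero}
           (λ { zero _ → ≈ᴹ-refl ; (suc zero) _ → ≈ᴹ-sym x₀≈x₁ ; (suc (suc j)) _ → ≈ᴹ-refl }))
         (trans (φ≡ΣT (x ∘ punch)) (sum-zero λ i → let (_ , j , vanish) = killable₃ (S i) in
           vanish (x ∘ punch) (∈W _ (x∈ (punch j)) i)))
    where
    punch : Fin 3 → Fin 4
    punch zero    = zero
    punch (suc j) = suc (suc j)
  degenerate-cut {3} {0} _ _ _ _ _ _ _ = [] , z≤n , λ _ _ _ _ _ ()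
  degenerate-cut {3} {1} _ _ _ _ _ _ _ = [] , z≤n , λ { _ zero _ _ () ; _ (suc _) _ _ _ (s≤s ()) }
  -- Five variables with at least four symmetric ones, so positions 2 and 3 may be exchanged. With
  -- fewer symmetric variables there is again no admissible pair.
  degenerate-cut {3} {suc (suc m)} _ 0<r {α} A α-sym {N} {T} N≤r S φ≡ΣT = L , L≤ , degenerate
    where
    M : ℕ
    M = 4 ℕ.+ m

    transpose-fixes : ∀ {i j : Fin 5} → toℕ i < M → toℕ j < M →
                      ∀ l → M ≤ toℕ l → transpose i j ⟨$⟩ʳ l ≡ l
    transpose-fixes i<M j<M l M≤l = transpose-fix _ _
      (λ { refl → ℕ.<⇒≱ i<M M≤l }) (λ { refl → ℕ.<⇒≱ j<M M≤l })

    2<M : 2 < M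
    2<M = s≤s (s≤s (s≤s z≤n))

    3<M : 3 < M
    3<M = s≤s (s≤s (s≤s (s≤s z≤n)))

    φ : Form 4
    φ y = α (y ∘ pinch zero)

    φ-swap : ∀ e a b c → φ (quad e a b c) ≡ φ (quad e b a c)
    φ-swap e a b c = trans
      (sym (α-sym (transpose 2F 3F) (transpose-fixes 2<M 3<M) (quad e a b c ∘ pinch zero)))
      (MultilinearIn.local A λ { 0F _ → ≈ᴹ-refl ; 1F _ → ≈ᴹ-refl ; 2F _ → ≈ᴹ-refl
                               ; 3F _ → ≈ᴹ-refl ; 4F _ → ≈ᴹ-refl })

    φ-linear : ∀ e c → IsLinear (λ d → φ (quad e d d c))
    φ-linear e c = record
      { ≈-cong = λ {u} {v} u≈v → trans (φ≡ u) (trans (≈-cong u≈v) (sym (φ≡ v)))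
      ; +-homo = λ u v → trans (φ≡ (u +ᴹ v)) (trans (+-homo u v) (sym (cong₂ _+_ (φ≡ u) (φ≡ v))))
      }
      where
      x : Fin 5 → Carrierᴹ
      x = quad e 0ᴹ 0ᴹ c ∘ pinch zero
      open IsLinear (pair-linear A α-sym {2F} {3F} (λ ()) 2<M 3<M x)
      φ≡ : ∀ d → φ (quad e d d c) ≡ α (x [ 2F , 3F ≔ d , d ])
      φ≡ d = MultilinearIn.local A λ { 0F _ → ≈ᴹ-refl ; 1F _ → ≈ᴹ-refl ; 2F _ → ≈ᴹ-refl
                                     ; 3F _ → ≈ᴹ-refl ; 4F _ → ≈ᴹ-refl }

    cut = cut₅ S {φ} φ≡ΣT φ-swap φ-linear
    L = proj₁ (proj₁ (proj₂ cut))
    L≤ = ℕ.≤-trans (proj₁ (proj₂ (proj₁ (proj₂ cut)))) (bound N≤r 0<r)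

    degenerate₂₃ : ∀ x → (∀ j → Kernel L (x j)) → x 0F ≈ᴹ x 1F → x 2F ≈ᴹ x 3F → α x ≡ 0ℙ
    degenerate₂₃ x x∈ x₀≈x₁ x₂≈x₃ = trans
      (MultilinearIn.local A {y = quad (x 0F) (x 2F) (x 2F) (x 4F) ∘ pinch zero}
        λ { 0F _ → ≈ᴹ-refl ; 1F _ → ≈ᴹ-sym x₀≈x₁ ; 2F _ → ≈ᴹ-refl
          ; 3F _ → ≈ᴹ-sym x₂≈x₃ ; 4F _ → ≈ᴹ-refl })
      (proj₂ (proj₂ cut) (∈P 0F) (∈P 2F) (∈P 4F))
      where
      ∈P : ∀ j → proj₁ cut (x j)
      ∈P j = proj₂ (proj₂ (proj₁ (proj₂ cut))) (x j) (x∈ j)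

    degenerate : DegenerateOn (2 ℕ.+ m) α (Kernel L)
    degenerate 0F 1F x x∈ _ _ x₀≈x₁ x₂≈x₃ = degenerate₂₃ x x∈ x₀≈x₁ x₂≈x₃
    -- The pairs of positions (2, 4) and (3, 4) arise only if position 4 is symmetric too; a
    -- transposition then moves them to (2, 3).
    degenerate 0F 2F x x∈ _ 2<m x₀≈x₁ x₂≈x₄ = trans
      (sym (α-sym (transpose 3F 4F) (transpose-fixes 3<M (s≤s (s≤s 2<m))) x))
      (degenerate₂₃ (x ∘ (transpose 3F 4F ⟨$⟩ʳ_)) (λ j → x∈ (transpose 3F 4F ⟨$⟩ʳ j)) x₀≈x₁ x₂≈x₄)
    degenerate 1F 2F x x∈ _ 2<m x₀≈x₁ x₃≈x₄ = trans
      (sym (α-sym (transpose 2F 4F) (transpose-fixes 2<M (s≤s (s≤s 2<m))) x))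
      (degenerate₂₃ (x ∘ (transpose 2F 4F ⟨$⟩ʳ_)) (λ j → x∈ (transpose 2F 4F ⟨$⟩ʳ j)) x₀≈x₁ (≈ᴹ-sym x₃≈x₄))
    degenerate 0F 0F _ _ ()
    degenerate 1F 0F _ _ ()
    degenerate 2F 0F _ _ ()
    degenerate 1F 1F _ _ (s≤s ())
    degenerate 2F 1F _ _ (s≤s ())
    degenerate 2F 2F _ _ (s≤s (s≤s ()))
  degenerate-cut {suc (suc (suc (suc k)))} (s≤s (s≤s (s≤s (s≤s (s≤s ())))))

-- Bounds for exp

ι : ℕ → ℚ
ι n = ℤ.+ n ℚ./ 1

private
  toℚᵘ-ι : ∀ n → ℚ.toℚᵘ (ι n) ℚᵘ.≃ mkℚᵘ (ℤ.+ n) 0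
  toℚᵘ-ι n = ℚ.toℚᵘ-fromℚᵘ (mkℚᵘ (ℤ.+ n) 0)

ι-* : ∀ m n → ι (m * n) ≡ ι m ℚ.* ι n
ι-* m n = ℚ.toℚᵘ-injective (ℚᵘ.≃-trans (toℚᵘ-ι (m * n)) (ℚᵘ.≃-sym
  (ℚᵘ.≃-trans (ℚ.toℚᵘ-homo-* (ι m) (ι n)) (ℚᵘ.≃-trans (ℚᵘ.*-cong (toℚᵘ-ι m) (toℚᵘ-ι n))
    (*≡* (cong (ℤ._* ℤ.+ 1) (sym (ℤ.pos-* m n))))))))

ι-mono-≤ : ∀ {m n} → m ≤ n → ι m ℚ.≤ ι n
ι-mono-≤ {m} {n} m≤n = ℚ.toℚᵘ-cancel-≤ (ℚᵘ.≤-respˡ-≃ (ℚᵘ.≃-sym (toℚᵘ-ι m))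
  (ℚᵘ.≤-respʳ-≃ (ℚᵘ.≃-sym (toℚᵘ-ι n)) (*≤* (ℤ.*-monoʳ-≤-nonNeg (ℤ.+ 1) (ℤ.+≤+ m≤n)))))

0≤p*q : ∀ {p q} → 0ℚ ℚ.≤ p → 0ℚ ℚ.≤ q → 0ℚ ℚ.≤ p ℚ.* q
0≤p*q {p} {q} 0≤p 0≤q = subst (ℚ._≤ p ℚ.* q) (ℚ.*-zeroʳ p)
  (ℚ.*-monoˡ-≤-nonNeg p {{ℚ.nonNegative 0≤p}} 0≤q)

module _ {q} (0≤q : 0ℚ ℚ.≤ q) where

  expTerm-nonNeg : ∀ i → 0ℚ ℚ.≤ expTerm q i
  expTerm-nonNeg zero    = ι-mono-≤ {0} {1} z≤n
  expTerm-nonNeg (suc i) = 0≤p*q (expTerm-nonNeg i)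
    (0≤p*q 0≤q (ℚ.<⇒≤ (ℚ.positive⁻¹ (ℤ.+ 1 ℚ./ suc i) {{ℚ.normalize-pos 1 (suc i)}})))

  expSum-mono : ∀ i → expSum q i ℚ.≤ expSum q (suc i)
  expSum-mono i = subst (ℚ._≤ expSum q (suc i)) (ℚ.+-identityʳ (expSum q i))
    (ℚ.+-monoʳ-≤ (expSum q i) (expTerm-nonNeg (suc i)))

  expSum-nonNeg : ∀ i → 0ℚ ℚ.≤ expSum q i
  expSum-nonNeg zero    = expTerm-nonNeg zero
  expSum-nonNeg (suc i) = ℚ.≤-trans (expSum-nonNeg i) (expSum-mono i)

  expTerm≤expSum : ∀ {i n} → i ℕ.≤′ n → expTerm q i ℚ.≤ expSum q n
  expTerm≤expSum {zero}  ℕ.≤′-refl        = ℚ.≤-refl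
  expTerm≤expSum {suc i} ℕ.≤′-refl        = subst (ℚ._≤ expSum q (suc i)) (ℚ.+-identityˡ (expTerm q (suc i)))
    (ℚ.+-monoˡ-≤ (expTerm q (suc i)) (expSum-nonNeg i))
  expTerm≤expSum {n = suc n} (ℕ.≤′-step i≤′n) = ℚ.≤-trans (expTerm≤expSum i≤′n) (expSum-mono n)

  expTerm₁ : expTerm q 1 ≡ q
  expTerm₁ = trans (ℚ.*-identityˡ (q ℚ.* 1ℚ)) (ℚ.*-identityʳ q)

  q≤expSum : ∀ {n} → 1 ≤ n → q ℚ.≤ expSum q n
  q≤expSum {n} 1≤n = subst (ℚ._≤ expSum q n) expTerm₁ (expTerm≤expSum (ℕ.≤⇒≤′ 1≤n))

0≤ι : ∀ n → 0ℚ ℚ.≤ ι n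
0≤ι n = ι-mono-≤ {0} {n} z≤n

≤ℝ-intro : ∀ {m x} N → (∀ n → N ≤ n → ι m ℚ.≤ x n) → m ≤ℝ x
≤ℝ-intro {m} {x} N m≤x ε 0<ε = N , λ n N≤n → ℚ.≤-trans (m≤x n N≤n)
  (subst (ℚ._≤ x n ℚ.+ ε) (ℚ.+-identityʳ (x n)) (ℚ.+-monoʳ-≤ (x n) (ℚ.<⇒≤ 0<ε)))

-- e^x ≥ x²/2 at x = 2h.
≤ℝ-exp : ∀ {c} h → c ≤ h * 2 * h → c ≤ℝ exp (fromℕ (h * 2))
≤ℝ-exp {c} h c≤ = ≤ℝ-intro {c} 2 λ n 2≤n → ℚ.≤-trans (ι-mono-≤ c≤)
  (subst (ℚ._≤ expSum q n) expTerm₂ (expTerm≤expSum (0≤ι (h * 2)) (ℕ.≤⇒≤′ 2≤n)))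
  where
  q = ι (h * 2)
  open ≡-Reasoning
  expTerm₂ : expTerm q 2 ≡ ι (h * 2 * h)
  expTerm₂ = begin
    expTerm q 1 ℚ.* (q ℚ.* ℚ.½)
      ≡⟨ cong₂ ℚ._*_ (expTerm₁ (0≤ι (h * 2))) (cong (ℚ._* ℚ.½) (ι-* h 2)) ⟩
    q ℚ.* (ι h ℚ.* ι 2 ℚ.* ℚ.½)
      ≡⟨ cong (q ℚ.*_) (trans (ℚ.*-assoc (ι h) (ι 2) ℚ.½) (ℚ.*-identityʳ (ι h))) ⟩
    q ℚ.* ι h
      ≡⟨ ι-* (h * 2) h ⟨
    ι (h * 2 * h) ∎

-- The linear Taylor term gives e^x ≥ x for nonnegative x and is present in every partial sum from
-- index 1 on; this is applied twice.
≤ℝ-exp-exp : ∀ {s m} → s ≤ m → s ≤ℝ exp (exp (fromℕ m))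
≤ℝ-exp-exp {s} {m} s≤m = ≤ℝ-intro {s} 1 λ n 1≤n → ℚ.≤-trans (ι-mono-≤ s≤m)
  (ℚ.≤-trans (q≤expSum (0≤ι m) 1≤n) (q≤expSum (expSum-nonNeg (0≤ι m) n) 1≤n))

-- Restriction to the subspace and assembly of the result

module Restriction {V : VectorSpace} (W : Subspace V) where
  open Subspace W using (space; inclusion)

  restriction : ∀ {k} → Forms.Form V k → Forms.Form space k
  restriction f x = f (inclusion ∘ x)

  restriction-in : ∀ {k} {P : Pred (Fin k) 0ℓ} {f} → Forms.MultilinearIn V P f →
                   Forms.MultilinearIn space P (restriction f)
  restriction-in F = record
    { local    = λ x≈y → Forms.MultilinearIn.local F x≈y
    ; additive = λ Pj y≈x z≈x eq → Forms.MultilinearIn.additive F Pj y≈x z≈x eq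
    }

  restriction-splitting : ∀ {k} {f : Forms.Form V k} → Forms.Splitting V f → Forms.Splitting space (restriction f)
  restriction-splitting S = record
    { I = I ; I-nonempty = I-nonempty ; ∁I-nonempty = ∁I-nonempty
    ; β = restriction β ; γ = restriction γ
    ; β-in = restriction-in β-in ; γ-in = restriction-in γ-in
    ; splits = λ x → splits (inclusion ∘ x)
    }
    where open Forms.Splitting S

module Construction {k m r n : ℕ} (K≤5 : 2 ℕ.+ k ≤ 5) (0<r : 0 < r) (α : (Fin (2 ℕ.+ k) → ∣ F₂^ n ∣) → F₂)
  (α-multilinear : IsMultilinear (F₂^ n) α) (α-sym : SymmetricInFirst (2 ℕ.+ m) α)
  (φ-rank : PartitionRankAtMost (F₂^ n) (λ y → α (y ∘ pinch zero)) r) where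

  private
    K : ℕ
    K = 2 ℕ.+ k

    module G = Forms (F₂^ n)

    N = proj₁ φ-rank
    N≤r = proj₁ (proj₂ φ-rank)
    decomposition = G.fromDecomposition (proj₂ (proj₂ φ-rank))
    S = proj₁ (proj₂ decomposition)
    φ≡ΣT = proj₂ (proj₂ decomposition)
    α-in = G.multilinearIn α-multilinear
    cut = Degeneracy.degenerate-cut n K≤5 0<r α-in α-sym N≤r S φ≡ΣT

  W : Subspace (F₂^ n)
  W = Kernels.kernel (F₂^ n) (proj₁ cut)

  open Subspace W using (space; inclusion)
  open Restriction W
  open Forms space

  private
    codimension = kernel-codimension n (proj₁ cut)
    c = proj₁ codimension
    dim-W = proj₁ (proj₂ (proj₂ (proj₂ codimension)))

  -- The 5r² equations are absorbed by e^x ≥ x²/2 at x = 50r, which provides 1250r².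
  c≤ : c ≤ℝ exp (fromℕ (50 * r))
  c≤ = subst (λ x → c ≤ℝ exp (fromℕ x)) (double r) (≤ℝ-exp {c} (25 * r) (begin
    c                      ≤⟨ proj₁ (proj₂ (proj₂ codimension)) ⟩
    length (proj₁ cut)     ≤⟨ proj₁ (proj₂ cut) ⟩
    5 * (r * r)            ≤⟨ ℕ.*-monoˡ-≤ (r * r) (ℕ.≤ᵇ⇒≤ 5 1250 _) ⟩
    1250 * (r * r)         ≡⟨ square r ⟩
    25 * r * 2 * (25 * r)  ∎))
    where
    open ℕ.≤-Reasoning
    double : ∀ r → 25 * r * 2 ≡ 50 * r
    double = solve-∀
    square : ∀ r → 1250 * (r * r) ≡ 25 * r * 2 * (25 * r)
    square = solve-∀

  W-codimension : ∃[ c ] HasCodimension W c × c ≤ℝ exp (fromℕ (50 * r))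
  W-codimension = c , (proj₁ (proj₂ codimension) , proj₂ (proj₂ (proj₂ codimension))) , c≤

  αᵂ : Form K
  αᵂ = restriction α

  αᵂ-in : MultilinearIn U αᵂ
  αᵂ-in = restriction-in α-in

  αᵂ-sym : SymmetricInFirst (2 ℕ.+ m) αᵂ
  αᵂ-sym π fixes x = α-sym π fixes (inclusion ∘ x)

  -- The basis is one of `W` itself, so inserting basis vectors keeps a tuple inside `W`, where the
  -- equations of the cut hold.
  open Symmetrisation space (proj₂ dim-W) {k} {m} αᵂ-in αᵂ-sym

  degenerate : Degenerate
  degenerate p q x = proj₂ (proj₂ cut) p q (inclusion ∘ x) (proj₂ ∘ x)

  α′ : Form K
  α′ x = αᵂ x + σ x

  α′-multilinear : IsMultilinear space α′
  α′-multilinear = isMultilinear _≟_ (+-multilinear αᵂ-in σ-in)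

  α′-sym : SymmetricInFirst (2 ℕ.+ m) α′
  α′-sym π fixes x = cong₂ _+_ (αᵂ-sym π fixes x) (σ-sym π fixes x)

  -- `σ` agrees with `αᵂ` on the diagonal, and the two copies cancel in characteristic 2.
  α′-diagonal : ∀ x → α′ (x ∘ pinch zero) ≡ 0ℙ
  α′-diagonal x = trans (cong (αᵂ y +_) (σ-diagonal degenerate y (λ _ → refl))) (ℙ.p+p≡0ℙ (αᵂ y))
    where y = x ∘ pinch zero

  σ-rank : PRank≤ σ (K * (K * r))
  σ-rank = σ-PRank≤ (N , N≤r , sumOfSplittings (restriction-splitting ∘ S) (λ x → φ≡ΣT (inclusion ∘ x)))

  private
    s = proj₁ σ-rank

  s≤ : s ≤ 50 * r ^ 1
  s≤ = begin
    s            ≤⟨ proj₁ (proj₂ σ-rank) ⟩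
    K * (K * r)  ≤⟨ ℕ.*-mono-≤ K≤5 (ℕ.*-monoˡ-≤ r K≤5) ⟩
    5 * (5 * r)  ≡⟨ ℕ.*-assoc 5 5 r ⟨
    25 * r       ≤⟨ ℕ.*-monoˡ-≤ r (ℕ.≤ᵇ⇒≤ 25 50 _) ⟩
    50 * r       ≡⟨ cong (50 *_) (ℕ.^-identityʳ r) ⟨
    50 * r ^ 1   ∎
    where open ℕ.≤-Reasoning

  α+α′-rank : ∃[ s ] PartitionRankAtMost space (λ x → α (inclusion ∘ x) + α′ x) s ×
                     s ≤ℝ exp (exp (fromℕ (50 * r ^ 1)))
  -- The two copies of `α` cancel and leave `σ`.
  α+α′-rank = s , (s , ℕ.≤-refl , toDecomposition
    (≗-sumOfSplittings (λ x → cancel (αᵂ x) (σ x)) (proj₂ (proj₂ σ-rank)))) , ≤ℝ-exp-exp {s} {50 * r ^ 1} s≤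
    where
    cancel : ∀ p q → p + (p + q) ≡ q
    cancel p q = trans (sym (ℙ.+-assoc p p q)) (cong (_+ q) (ℙ.p+p≡0ℙ p))

theorem11 : ∃[ A ] ∃[ B ] ∃[ t ]
    0 < A × 0 < B ×
    (∀ (k m r n : ℕ) (2≤k : 2 ≤ k) → k ≤ 5 → 2 ≤ m → m ≤ k → 0 < r →
    (α : (Fin k → ∣ F₂^ n ∣) → F₂) →
    IsMultilinear (F₂^ n) α →
    SymmetricInFirst m α →
    PartitionRankAtMost (F₂^ n) (diagonal 2≤k α) r →
    Σ (Subspace (F₂^ n)) λ U → let open Subspace U in
    (∃[ c ] HasCodimension U c × c ≤ℝ exp^ t (fromℕ (A * r))) ×
    Σ ((Fin k → ∣ space ∣) → F₂) λ α′ →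
    IsMultilinear space α′ ×
    SymmetricInFirst m α′ ×
    (∀ x → diagonal 2≤k α′ x ≡ 0ℙ) ×
    (∃[ s ] PartitionRankAtMost space (λ x → α (inclusion ∘ x) + α′ x) s ×
    s ≤ℝ exp (exp (fromℕ (A * r ^ B)))))
-- 50 is twice the bound 25 on the number of position pairs, and even so that `A * r` has the form
-- `h * 2`. The rank bound is linear in `r`, so `B` is 1; one exponential covers the codimension, so
-- `t` is 1.
theorem11 = 50 , 1 , 1 , s≤s z≤n , s≤s z≤n ,
  λ { _ _ _ _ (s≤s (s≤s _)) k≤5 (s≤s (s≤s _)) _ 0<r α α-multilinear α-sym φ-rank →
    let open Construction k≤5 0<r α α-multilinear α-sym φ-rank
    in W , W-codimension , α′ , α′-multilinear , α′-sym , α′-diagonal , α+α′-rank }
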